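{- Let $n\ge 4$. In the transversal achievement game on the $n\times n$ board, the strategy for the first player X described in the context is well defined at every ply (every choice it calls for is available), and X, following it, wins against every play of O by ply $2n+3$, i.e. no later than with X's $(n+2)$-nd stone.
   Context: Game. The board has row set $R$ and column set $C$, $|R|=|C|=n$; cells are pairs $(r,c)\in R\times C$. Players X (first) and O (second) alternately claim (place a stone on) a free cell, i.e. a cell occupied by neither player; X's $k$-th stone is placed at ply $2k-1$, O's $k$-th stone at ply $2k$. A matching is a set of cells no two of which share a row or a column; a transversal is a matching of size $n$. For a set $S$ of cells, $\nu(S)$ is the maximum size of a matching contained in $S$. The first player whose set $S$ of stones satisfies $\nu(S)=n$ wins. A cell $f$ completes $S$ if $\nu(S\cup\{f\})=n$. Strategy of X. Phase 1 (X's moves $1,\dots,n-2$). At any time let $U_R,U_C$ be the sets of rows, resp. columns, containing no X-stone, and let $H=U_R\times U_C$ (the open block). Move $1$: any cell. Move $k$ ($2\le k\le n-2$): let $x$ be O's most recent stone; if $x\in H$, play a free cell of $H$ in $x$'s row; otherwise play any free cell of $H$. Tie-break (X's move $n-1$). Just before this move $H=\{u_1,u_2\}\times\{v_1,v_2\}$. Let $F$ be the set of the $n-2$ O-stones already placed. If X plays $(u_a,v_c)$ with $a,c\in\{1,2\}$, put $(b,d)=(u_{3-a},v_{3-c})$ (the outcome). A cell of $H$ is admissible if it is free and its opposite corner in $H$ is free; an outcome is admissible if it comes from an admissible cell. For an outcome $(b,d)$ let $w=|F\cap(\text{row }b\cup\text{column }d)|$. X chooses an admissible outcome with $1\le w\le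 n-3$ if one exists; otherwise any admissible outcome with $w\le n-3$. Phase 2. After move $n-1$ (ply $2n-3$) X's stones form a matching $M$ of size $n-1$ missing exactly row $b$ and column $d$; let $\sigma:R\setminus\{b\}\to C\setminus\{d\}$ be the induced bijection, so $M=\{(i,\sigma(i)):i\neq b\}$. A row $s\in R\setminus\{b\}$ is live if $(s,d)$ and $(b,\sigma(s))$ are both free right after ply $2n-3$. For distinct live rows $r,s$: plan (i) is to play $(b,\sigma(r))$ at ply $2n-1$ and $(s,d)$ at ply $2n+1$, and the pair $(r,s)$ is admissible for plan (i) if the cross cell $(r,\sigma(s))$ is free right after ply $2n-3$; plan (ii) is to play $(r,d)$ at ply $2n-1$ and $(b,\sigma(s))$ at ply $2n+1$, and the pair is admissible for plan (ii) if the cross cell $(s,\sigma(r))$ is free right after ply $2n-3$. Choice of plan and pair: if $F$ meets column $d$, use plan (i) with any admissible pair; else if $F$ meets row $b$, use plan (ii) with any admissible pair; else ($w=0$), if $\nu(F)\le n-3$ use plan (i) with any admissible pair, and if $\nu(F)=n-2$ use plan (i) with $s:=u_a$ (the row of X's move $n-1$) and any live $r\ne u_a$. Deviation rule. If O at ply $2n-2$, $2n$ or $2n+2$ leaves free some cell that completes X's set, X immediately plays such a cell (in particular at ply $2n+3$ X plays a remaining free completing cell); otherwise X continues the plan. -}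

module Defs where

open import Data.Fin using (Fin; opposite)
open import Data.Fin.Permutation using (Permutation′; _⟨$⟩ʳ_)
import Data.Fin.Properties as Fin
open import Data.List using (List; []; _∷_; _++_; map; filter; foldr; length)
open import Data.List.Membership.Propositional using (_∈_; _∉_)
open import Data.List.Relation.Unary.All using (All)
open import Data.List.Relation.Unary.AllPairs using (AllPairs; allPairs?)
open import Data.List.Relation.Unary.Any using (Any)
open import Data.Nat using (ℕ; suc; _+_; _∸_; _⊔_; _≤_)
open import Data.Product using (_×_; _,_; proj₁; proj₂; ∃; ∃-syntax)
open import Data.Sum using (_⊎_)
open import Function.Bundles using (_⇔_)
open import Function.Definitions using (Injective)
open import Relation.Binary.PropositionalEquality using (_≡_; _≢_)
open import Relation.Nullary using (¬_; Dec; _×-dec_; _⊎-dec_; ¬?)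

sublists : ∀ {A : Set} → List A → List (List A)
sublists []       = [] ∷ []
sublists (x ∷ xs) = sublists xs ++ map (x ∷_) (sublists xs)

module Game (n : ℕ) where

  Row Col Cell : Set
  Row  = Fin n
  Col  = Fin n
  Cell = Row × Col

  row : Cell → Row
  row = proj₁

  col : Cell → Col
  col = proj₂

  -- Finite sets of cells are given as lists; stones are listed with the most
  -- recent one first.
  Cells : Set
  Cells = List Cell

  DistinctLines : Cell → Cell → Set
  DistinctLines p q = row p ≢ row q × col p ≢ col q

  Matching : Cells → Set
  Matching = AllPairs DistinctLines

  matching? : (S : Cells) → Dec (Matching S)
  matching? = allPairs? λ p q →
    ¬? (row p Fin.≟ row q) ×-dec ¬? (col p Fin.≟ col q)

  ν : Cells → ℕ
  ν S = foldr _⊔_ 0 (map length (filter matching? (sublists S)))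

  Completes : Cell → Cells → Set
  Completes f S = ν (f ∷ S) ≡ n

  -- In the following, xs and os are the stones of X and of O.

  Free : (xs os : Cells) → Cell → Set
  Free xs os c = c ∉ xs × c ∉ os

  BoardFull : (xs os : Cells) → Set
  BoardFull xs os = ∀ c → ¬ Free xs os c

  Over : (xs os : Cells) → Set
  Over xs os = ν xs ≡ n ⊎ ν os ≡ n ⊎ BoardFull xs os

  OpenRow : Cells → Row → Set
  OpenRow xs r = All (λ x → row x ≢ r) xs

  OpenCol : Cells → Col → Set
  OpenCol xs c = All (λ x → col x ≢ c) xs

  OpenBlock : Cells → Cell → Set
  OpenBlock xs c = OpenRow xs (row c) × OpenCol xs (col c)

  data Phase1 : (xs os : Cells) → Cell → Set where
    first   : ∀ {c} → Phase1 [] [] c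
    inside  : ∀ {y xs x os c} →
              OpenBlock (y ∷ xs) x →
              OpenBlock (y ∷ xs) c → Free (y ∷ xs) (x ∷ os) c →
              row c ≡ row x →
              Phase1 (y ∷ xs) (x ∷ os) c
    outside : ∀ {y xs x os c} →
              ¬ OpenBlock (y ∷ xs) x →
              OpenBlock (y ∷ xs) c → Free (y ∷ xs) (x ∷ os) c →
              Phase1 (y ∷ xs) (x ∷ os) c

  -- |F ∩ (row b ∪ column d)|
  weight : (F : Cells) → Cell → ℕ
  weight F (b , d) =
    length (filter (λ f → (row f Fin.≟ b) ⊎-dec (col f Fin.≟ d)) F)

  record Corners (xs : Cells) : Set where
    field
      u      : Fin 2 → Row
      v      : Fin 2 → Col
      u-inj  : Injective _≡_ _≡_ u
      v-inj  : Injective _≡_ _≡_ v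
      u-open : ∀ r → OpenRow xs r ⇔ (∃[ a ] u a ≡ r)
      v-open : ∀ c → OpenCol xs c ⇔ (∃[ a ] v a ≡ c)

    corner opposite-corner : Fin 2 → Fin 2 → Cell
    corner a c          = u a , v c
    opposite-corner a c = u (opposite a) , v (opposite c)

  module _ {xs : Cells} (k : Corners xs) (F : Cells) where
    open Corners k

    Admissible : Fin 2 → Fin 2 → Set
    Admissible a c = Free xs F (corner a c) × Free xs F (opposite-corner a c)

    Eligible : Fin 2 → Fin 2 → Set
    Eligible a c = Admissible a c × weight F (opposite-corner a c) ≤ n ∸ 3

    Preferred : Fin 2 → Fin 2 → Set
    Preferred a c = Eligible a c × 1 ≤ weight F (opposite-corner a c)

    TieBreak : Fin 2 → Fin 2 → Set
    TieBreak a c =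
      Preferred a c ⊎ ((∀ a′ c′ → ¬ Preferred a′ c′) × Eligible a c)

  -- A bijection R ∖ {b} → C ∖ {d} is the same as a permutation sending b to d;
  -- σ is this extension of the bijection induced by M.
  record Induces (M : Cells) (b : Row) (d : Col) (σ : Permutation′ n) : Set where
    field
      matching : Matching M
      b↦d      : σ ⟨$⟩ʳ b ≡ d
      graph    : ∀ i j → (i , j) ∈ M ⇔ (i ≢ b × σ ⟨$⟩ʳ i ≡ j)

  -- M and F are the stones of X and of O right after ply 2n-3, ua is the row of
  -- X's move n-1.
  module Phase2 (M F : Cells) (ua b : Row) (d : Col) (σ : Permutation′ n) where

    Live : Row → Set
    Live s = s ≢ b × Free M F (s , d) × Free M F (b , σ ⟨$⟩ʳ s)

    Admissible-i : Row → Row → Set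
    Admissible-i r s = Live r × Live s × r ≢ s × Free M F (r , σ ⟨$⟩ʳ s)

    Admissible-ii : Row → Row → Set
    Admissible-ii r s = Live r × Live s × r ≢ s × Free M F (s , σ ⟨$⟩ʳ r)

    MeetsCol MeetsRow : Set
    MeetsCol = Any (λ f → col f ≡ d) F
    MeetsRow = Any (λ f → row f ≡ b) F

    -- Plan p q : the strategy allows the plan to play p at ply 2n-1 and q at
    -- ply 2n+1.  In the last case s is ua, with no condition on the pair beyond
    -- r being live and different from s.
    data Plan : Cell → Cell → Set where
      meets-col : ∀ {r s} → MeetsCol →
               Admissible-i r s →
               Plan (b , σ ⟨$⟩ʳ r) (s , d)
      meets-row : ∀ {r s} → ¬ MeetsCol → MeetsRow →
               Admissible-ii r s →
               Plan (r , d) (b , σ ⟨$⟩ʳ s)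
      meets-none-small : ∀ {r s} → ¬ MeetsCol → ¬ MeetsRow → ν F ≤ n ∸ 3 →
               Admissible-i r s →
               Plan (b , σ ⟨$⟩ʳ r) (s , d)
      meets-none-large : ∀ {r} → ¬ MeetsCol → ¬ MeetsRow → ν F ≡ n ∸ 2 →
               Live r → r ≢ ua →
               Plan (b , σ ⟨$⟩ʳ r) (ua , d)

  -- What X remembers besides the stones: nothing up to move n-1; then the
  -- outcome (b , d) of the tie-break (used at ply 2n-1); then the second cell
  -- of the chosen plan (used at ply 2n+1); then that the plan is finished
  -- (ply 2n+3).
  data Memory : Set where
    opening  : Memory
    outcome  : (b : Row) (d : Col) → Memory
    pending  : (q : Cell) → Memory
    finished : Memory

  data InPhase2 : Memory → Set where
    outcome  : ∀ {b d} → InPhase2 (outcome b d)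
    pending  : ∀ {q} → InPhase2 (pending q)
    finished : InPhase2 finished

  CannotComplete : (xs os : Cells) → Set
  CannotComplete xs os = ∀ c → Free xs os c → ¬ Completes c xs

  -- Prescribes m xs os c m′ : with memory m, and X to move, c is one of the
  -- moves the strategy allows, and m′ is X's memory afterwards.  Moves of a
  -- plan are prescribed whether or not they are free at that time.
  data Prescribes : Memory → (xs os : Cells) → Cell → Memory → Set where
    phase1   : ∀ {xs os c} →
               suc (length xs) ≤ n ∸ 2 →
               Phase1 xs os c →
               Prescribes opening xs os c opening
    tieBreak : ∀ {xs os} →
               suc (length xs) ≡ n ∸ 1 →
               (k : Corners xs) (let open Corners k) →
               ∀ {a c} → TieBreak k os a c →
               Prescribes opening xs os
                 (corner a c) (outcome (u (opposite a)) (v (opposite c)))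
    deviate  : ∀ {m xs os c} →
               InPhase2 m →
               Free xs os c → Completes c xs →
               Prescribes m xs os c m
    plan     : ∀ {b d x M y F p q} →
               CannotComplete (x ∷ M) (y ∷ F) →
               (σ : Permutation′ n) → Induces (x ∷ M) b d σ →
               Phase2.Plan (x ∷ M) F (row x) b d σ p q →
               Prescribes (outcome b d) (x ∷ M) (y ∷ F) p (pending q)
    continue : ∀ {q xs os} →
               CannotComplete xs os →
               Prescribes (pending q) xs os q finished

  data Player : Set where
    X O : Player

  -- Reachable t m xs os : some play in which X follows the strategy and O plays
  -- arbitrary legal moves leads to this position, with t to move next (if the
  -- game is not over) and with memory m of X.  No move is made once the game
  -- is over, so at most one player ever gets a transversal.
  data Reachable : Player → Memory → (xs os : Cells) → Set where
    start : Reachable X opening [] []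
    moveX : ∀ {m m′ xs os c} →
            Reachable X m xs os → ¬ Over xs os →
            Prescribes m xs os c m′ → Free xs os c →
            Reachable O m′ (c ∷ xs) os
    moveO : ∀ {m xs os c} →
            Reachable O m xs os → ¬ Over xs os →
            Free xs os c →
            Reachable X m xs (c ∷ os)

  WellDefined : Set
  WellDefined = ∀ {m xs os} → Reachable X m xs os → ¬ Over xs os →
    (∃[ c ] ∃[ m′ ] Prescribes m xs os c m′) ×
    (∀ {c m′} → Prescribes m xs os c m′ → Free xs os c)

  WinsByPly : ℕ → Set
  WinsByPly N = ∀ {t m xs os} → Reachable t m xs os →
    Over xs os ⊎ length xs + length os ≡ N → ν xs ≡ n

{-# OPTIONS --safe #-}
module Submission where

-- In the opening every O-stone in the open block loses its row to X's reply, so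
-- at the tie-break at most one O-stone lies in the 2 × 2 block H.  Two opposite corners of H have crosses (row ∪ column) meeting only
-- in H, so they cannot both contain all n - 2 ≥ 2 O-stones; this gives an
-- eligible outcome (b , d).
--
-- An O-stone spoils at most one of the n - 1 rows other than b: either by
-- making it not live, or by occupying a cross cell.  Counting against the n - 2
-- O-stones produces first two live rows and then an admissible pair.  O is
-- forced to take (b , d) and then the cell t completed by X's first plan move,
-- after which X has two completing cells.
--
-- O cannot get a transversal from F, (b , d), t and one more stone z: (b , d)
-- and t lie on one line, so if F meets that line or ν F ≤ n - 3 there are not
-- enough lines; and if w = 0 and ν F = n - 2, then, no outcome having a weight
-- strictly between 0 and n - 2, F misses both lines of X's move n - 1, so z
-- would have to be that very cell.

open import Defs
open import Data.Fin using (Fin; zero; suc; opposite; remQuot)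
open import Data.Fin.Permutation using (Permutation′; _⟨$⟩ʳ_; _∘ₚ_; transpose; permutation)
import Data.Fin.Properties as Fin
open import Data.List using (List; []; _∷_; _++_; map; filter; length; drop; allFin; tabulate)
open import Data.List.Properties using
  ( length-map; length-tabulate; length-++; length-removeAt′; length-filter; filter-notAll
  ; filter-none; filter-some; filter-complete; foldr-preservesᵒ
  )
open import Data.List.Membership.Propositional using (_∈_; _∉_; lose)
open import Data.List.Membership.Propositional.Properties using
  ( ∈-map⁺; ∈-map⁻; ∈-++⁺ˡ; ∈-++⁺ʳ; ∈-++⁻; ∈-filter⁺; ∈-filter⁻; ∈-allFin; ∈-tabulate⁻
  ; foldr-selective
  )
open import Data.List.Relation.Binary.Subset.Propositional using (_⊆_)
open import Data.List.Relation.Unary.All as All using (All; []; _∷_)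
import Data.List.Relation.Unary.All.Properties as All
open import Data.List.Relation.Unary.AllPairs as AllPairs using (AllPairs; []; _∷_)
import Data.List.Relation.Unary.AllPairs.Properties as AllPairs
open import Data.List.Relation.Unary.Any as Any using (Any; here; there; _─_)
open import Data.List.Relation.Unary.Unique.Propositional using (Unique)
import Data.List.Relation.Unary.Unique.Propositional.Properties as Unique
open import Data.Nat using (ℕ; suc; _+_; _*_; _≤_; _<_; _≤?_; z≤n; s≤s)
import Data.Nat.Properties as ℕ
open import Data.Nat.Solver using (module +-*-Solver)
open import Data.Product using (_×_; _,_; proj₁; proj₂; ∃₂; ∃-syntax)
open import Data.Product.Properties using (≡-dec)
open import Data.Sum using (_⊎_; inj₁; inj₂; [_,_]′)
open import Data.Unit using (tt)
open import Function using (_∘_; id; Injection; mk⇔; Equivalence; _⇔_)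
open import Function.Definitions using (Injective)
open import Function.Properties.Inverse using (↔⇒↣)
open import Relation.Binary.PropositionalEquality using
  ( _≡_; _≢_; refl; sym; trans; cong; cong₂; subst; subst₂; ≢-sym
  )
open import Relation.Nullary using (¬_; Dec; yes; no; contradiction; ¬?; _×-dec_; _⊎-dec_)
open import Relation.Nullary.Decidable using (dec-true; dec-false; decidable-stable)
open import Relation.Unary using (Decidable)

-- Lists and counting

module _ {A B : Set} where

  ∈-─ : ∀ {P Q : B → Set} {ys} (p : Any P ys) → Any Q ys → (∀ {y} → P y → ¬ Q y) → Any Q (ys ─ p)
  ∈-─ (here p)  (here q)  P#Q = contradiction q (P#Q p)
  ∈-─ (here p)  (there q) P#Q = q
  ∈-─ (there p) (here q)  P#Q = here q
  ∈-─ (there p) (there q) P#Q = there (∈-─ p q P#Q)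

  -- Each x only has to be related to some y, with no function chosen: since a y determines its x,
  -- the witness of x can be deleted from `ys` and the other elements keep theirs.
  pigeonhole : ∀ (R : A → B → Set) {xs ys} → Unique xs → All (λ x → Any (R x) ys) xs →
               (∀ {x x′ y} → R x y → R x′ y → x ≡ x′) → length xs ≤ length ys
  pigeonhole R []       []       inj = z≤n
  pigeonhole R {x ∷ xs} {ys} (x∉ ∷ u) (p ∷ ps) inj =
    subst (suc (length xs) ≤_) (sym (length-removeAt′ ys (Any.index p)))
      (s≤s (pigeonhole R u (All.zipWith (λ (x≢ , q) → ∈-─ p q (λ r r′ → x≢ (inj r r′))) (x∉ , ps)) inj))

module _ {A : Set} where

  ⊆⇒length≤ : {xs ys : List A} → Unique xs → xs ⊆ ys → length xs ≤ length ys
  ⊆⇒length≤ u xs⊆ys = pigeonhole _≡_ u (All.tabulate xs⊆ys) (λ p q → trans p (sym q))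

  module _ {P : A → Set} (P? : Decidable P) where

    length-filter-∁ : ∀ xs → length (filter P? xs) + length (filter (¬? ∘ P?) xs) ≡ length xs
    length-filter-∁ []       = refl
    length-filter-∁ (x ∷ xs) with P? x
    ... | yes _ = cong suc (length-filter-∁ xs)
    ... | no  _ = trans (ℕ.+-suc _ _) (cong suc (length-filter-∁ xs))

    filter-length≤⇒All : ∀ xs → length xs ≤ length (filter P? xs) → All P xs
    filter-length≤⇒All xs ≤f =
      subst (All P) (filter-complete P? (ℕ.≤-antisym (length-filter P? xs) ≤f)) (All.all-filter P? xs)

Unique⇒length≤ : ∀ {n} {xs : List (Fin n)} → Unique xs → length xs ≤ n
Unique⇒length≤ {n} {xs} u = subst (length xs ≤_) (length-tabulate id) (⊆⇒length≤ u (λ _ → ∈-allFin _))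

module _ {n : ℕ} where

  open import Data.List.Membership.DecPropositional (Fin._≟_ {n}) using (_∈?_)

  surjective : {xs : List (Fin n)} → Unique xs → n ≤ length xs → ∀ i → i ∈ xs
  surjective {xs} u n≤ i with i ∈? xs
  ... | yes i∈ = i∈
  ... | no  i∉ = contradiction (Unique⇒length≤ (All.¬Any⇒All¬ xs i∉ ∷ u)) (ℕ.<⇒≱ (s≤s n≤))

  abstract
    complement : List (Fin n) → List (Fin n)
    complement xs = filter (λ i → ¬? (i ∈? xs)) (allFin n)

    complement-unique : ∀ xs → Unique (complement xs)
    complement-unique xs = Unique.filter⁺ (λ i → ¬? (i ∈? xs)) (Unique.allFin⁺ n)

    ∈-complement⁺ : ∀ {xs i} → i ∉ xs → i ∈ complement xs
    ∈-complement⁺ {xs} i∉ = ∈-filter⁺ (λ i → ¬? (i ∈? xs)) (∈-allFin _) i∉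

    ∈-complement⁻ : ∀ {xs i} → i ∈ complement xs → i ∉ xs
    ∈-complement⁻ {xs} i∈ = proj₂ (∈-filter⁻ (λ i → ¬? (i ∈? xs)) {xs = allFin n} i∈)

    length-complement : ∀ {xs} → Unique xs → length xs + length (complement xs) ≡ n
    length-complement {xs} u = trans (sym (length-++ xs)) (ℕ.≤-antisym
      (Unique⇒length≤ (Unique.++⁺ u (complement-unique xs) (λ (i∈ , i∈∁) → ∈-complement⁻ i∈∁ i∈)))
      (subst (_≤ length (xs ++ complement xs)) (length-tabulate id)
        (⊆⇒length≤ (Unique.allFin⁺ n) (λ {i} _ → covers i))))
      where
      covers : ∀ i → i ∈ xs ++ complement xs
      covers i with i ∈? xs
      ... | yes i∈ = ∈-++⁺ˡ i∈
      ... | no  i∉ = ∈-++⁺ʳ xs (∈-complement⁺ i∉)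

two-members : ∀ {A : Set} {xs : List A} → Unique xs → 2 ≤ length xs → ∃₂ λ x y → x ≢ y × x ∈ xs × y ∈ xs
two-members ((x≢y ∷ _) ∷ _) (s≤s (s≤s _)) = _ , _ , x≢y , here refl , there (here refl)

-- Delivers two open lines in the form in which `Corners` stores them.
enumerate₂ : ∀ {A : Set} {xs : List A} → Unique xs → length xs ≡ 2 →
             ∃[ f ] Injective {A = Fin 2} _≡_ _≡_ f × (∀ x → x ∈ xs ⇔ (∃[ a ] f a ≡ x))
enumerate₂ {A} {x ∷ y ∷ []} ((x≢y ∷ []) ∷ _) refl = f , f-injective , λ z → mk⇔ to from
  where
  f : Fin 2 → A
  f zero       = x
  f (suc zero) = y
  f-injective : Injective _≡_ _≡_ f
  f-injective {zero}     {zero}     _  = refl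
  f-injective {zero}     {suc zero} eq = contradiction eq x≢y
  f-injective {suc zero} {zero}     eq = contradiction (sym eq) x≢y
  f-injective {suc zero} {suc zero} _  = refl
  to : ∀ {z} → z ∈ x ∷ y ∷ [] → ∃[ a ] f a ≡ z
  to (here refl)         = zero , refl
  to (there (here refl)) = suc zero , refl
  from : ∀ {z} → (∃[ a ] f a ≡ z) → z ∈ x ∷ y ∷ []
  from (zero     , refl) = here refl
  from (suc zero , refl) = there (here refl)

-- Matchings

sublists-∷ˡ : ∀ {A : Set} {x : A} xs {ys} → ys ∈ sublists xs → ys ∈ sublists (x ∷ xs)
sublists-∷ˡ _ = ∈-++⁺ˡ

sublists-∷ʳ : ∀ {A : Set} {x : A} xs {ys} → ys ∈ sublists xs → x ∷ ys ∈ sublists (x ∷ xs)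
sublists-∷ʳ {x = x} xs = ∈-++⁺ʳ (sublists xs) ∘ ∈-map⁺ (x ∷_)

sublists⇒⊆ : ∀ {A : Set} {xs ys : List A} → ys ∈ sublists xs → ys ⊆ xs
sublists⇒⊆ {xs = []}     (here refl) ()
sublists⇒⊆ {xs = x ∷ xs} ys∈ y∈ with ∈-++⁻ (sublists xs) ys∈
... | inj₁ ys∈′ = there (sublists⇒⊆ ys∈′ y∈)
... | inj₂ ys∈′ with ∈-map⁻ (x ∷_) ys∈′ | y∈
...   | _ , _ , refl    | here y≡x  = here y≡x
...   | _ , zs∈ , refl  | there y∈′ = there (sublists⇒⊆ zs∈ y∈′)

module _ {n : ℕ} where
  open Game n

  _≟ᶜ_ : (p q : Cell) → Dec (p ≡ q)
  _≟ᶜ_ = ≡-dec Fin._≟_ Fin._≟_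

  open import Data.List.Membership.DecPropositional _≟ᶜ_ using (_∈?_) public

  Matching⇒Unique : ∀ {T} → Matching T → Unique T
  Matching⇒Unique = AllPairs.map (λ (r≢ , _) p≡q → r≢ (cong row p≡q))

  Matching-pair : ∀ {T p q} → Matching T → p ∈ T → q ∈ T → p ≡ q ⊎ DistinctLines p q
  Matching-pair (_  ∷ _) (here refl) (here refl) = inj₁ refl
  Matching-pair (ds ∷ _) (here refl) (there q∈)  = inj₂ (All.lookup ds q∈)
  Matching-pair (ds ∷ _) (there p∈)  (here refl) = let r≢ , c≢ = All.lookup ds p∈ in inj₂ (≢-sym r≢ , ≢-sym c≢)
  Matching-pair (_  ∷ M) (there p∈)  (there q∈)  = Matching-pair M p∈ q∈

  -- `ν` sees only sublists of `S`, while `T` may list its cells in any order. `T` is rearranged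
  -- along `S`: a head x of `S` that occurs in `T` is put first and filtered out of `T`, so a
  -- repetition of x in `S` is not taken again.
  Matching⇒sublist : ∀ S {T} → Matching T → T ⊆ S →
                     ∃[ T′ ] T′ ∈ sublists S × Matching T′ × T′ ⊆ T × length T ≤ length T′
  Matching⇒sublist [] {[]}    M T⊆ = [] , here refl , [] , (λ ()) , z≤n
  Matching⇒sublist [] {x ∷ T} M T⊆ with () ← T⊆ (here refl)
  Matching⇒sublist (x ∷ S) {T} M T⊆ with x ∈? T
  ... | no x∉ =
    let T′ , T′∈ , M′ , T′⊆ , ≤T′ = Matching⇒sublist S M T⊆S in T′ , sublists-∷ˡ S T′∈ , M′ , T′⊆ , ≤T′
    where
    T⊆S : T ⊆ S
    T⊆S y∈ with T⊆ y∈
    ... | here refl = contradiction y∈ x∉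
    ... | there y∈S = y∈S
  ... | yes x∈ =
    let T′ , T′∈ , M′ , T′⊆ , ≤T′ = Matching⇒sublist S (AllPairs.filter⁺ ≢x? M) rest⊆S in
    x ∷ T′ , sublists-∷ʳ S T′∈ ,
    All.tabulate (λ y∈ → apart (T′⊆ y∈)) ∷ M′ ,
    (λ { (here refl) → x∈ ; (there y∈) → proj₁ (∈-filter⁻ ≢x? {xs = T} (T′⊆ y∈)) }) ,
    ℕ.≤-trans (⊆⇒length≤ (Matching⇒Unique M) T⊆x∷rest) (s≤s ≤T′)
    where
    ≢x? : Decidable (_≢ x)
    ≢x? y = ¬? (y ≟ᶜ x)
    rest = filter ≢x? T
    rest⊆S : rest ⊆ S
    rest⊆S y∈ with y∈T , y≢x ← ∈-filter⁻ ≢x? {xs = T} y∈ with T⊆ y∈T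
    ... | here y≡x  = contradiction y≡x y≢x
    ... | there y∈S = y∈S
    apart : ∀ {y} → y ∈ rest → DistinctLines x y
    apart y∈ with y∈T , y≢x ← ∈-filter⁻ ≢x? {xs = T} y∈ with Matching-pair M x∈ y∈T
    ... | inj₁ x≡y = contradiction (sym x≡y) y≢x
    ... | inj₂ d   = d
    T⊆x∷rest : T ⊆ x ∷ rest
    T⊆x∷rest {y} y∈ with y ≟ᶜ x
    ... | yes y≡x = here y≡x
    ... | no  y≢x = there (∈-filter⁺ ≢x? y∈ y≢x)

  -- With `ν-attained` this characterises `ν` as a maximum; the later bounds on `ν` rest on these
  -- two facts rather than on its definition.
  length≤ν : ∀ S {T} → Matching T → T ⊆ S → length T ≤ ν S
  length≤ν S {T} M T⊆ with T′ , T′∈ , M′ , _ , ≤T′ ← Matching⇒sublist S M T⊆ =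
    foldr-preservesᵒ {P = length T ≤_} (λ x y → [ ℕ.m≤n⇒m≤n⊔o y , ℕ.m≤n⇒m≤o⊔n x ]′) 0 _
      (inj₂ (lose (∈-map⁺ length (∈-filter⁺ matching? T′∈ M′)) ≤T′))

  ν-attained : ∀ S → ∃[ T ] Matching T × T ⊆ S × length T ≡ ν S
  ν-attained S with foldr-selective ℕ.⊔-sel 0 (map length (filter matching? (sublists S)))
  -- The fold returned its initial value 0, which the empty matching attains.
  ... | inj₁ ν≡0 = [] , [] , (λ ()) , sym ν≡0
  ... | inj₂ ν∈ with T , T∈ , ν≡ ← ∈-map⁻ length ν∈
                with T∈S , M ← ∈-filter⁻ matching? {xs = sublists S} T∈ =
    T , M , sublists⇒⊆ T∈S , sym ν≡

  ν-mono : ∀ S S′ → S ⊆ S′ → ν S ≤ ν S′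
  ν-mono S S′ S⊆ with T , M , T⊆ , ≡ν ← ν-attained S = subst (_≤ _) ≡ν (length≤ν S′ M (S⊆ ∘ T⊆))

  ν≤length : ∀ S → ν S ≤ length S
  ν≤length S with T , M , T⊆ , ≡ν ← ν-attained S =
    subst (_≤ _) ≡ν (⊆⇒length≤ (Matching⇒Unique M) T⊆)

  -- Lets one argument serve for rows and for columns.
  IsLine : (Cell → Fin n) → Set
  IsLine ℓ = ∀ {p q} → DistinctLines p q → ℓ p ≢ ℓ q

  row-isLine : IsLine row
  row-isLine = proj₁

  col-isLine : IsLine col
  col-isLine = proj₂

  module _ {ℓ : Cell → Fin n} (isLine : IsLine ℓ) where

    map-line-unique : ∀ {T} → Matching T → Unique (map ℓ T)
    map-line-unique M = AllPairs.map⁺ (AllPairs.map isLine M)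

    Matching-line-injective : ∀ {T p q} → Matching T → p ∈ T → q ∈ T → ℓ p ≡ ℓ q → p ≡ q
    Matching-line-injective M p∈ q∈ eq with Matching-pair M p∈ q∈
    ... | inj₁ p≡q = p≡q
    ... | inj₂ d   = contradiction eq (isLine d)

    Matching⇒length≤ : ∀ {T} → Matching T → length T ≤ n
    Matching⇒length≤ {T} M = subst (_≤ n) (length-map ℓ T) (Unique⇒length≤ (map-line-unique M))

    transversal-meets : ∀ {T} → Matching T → n ≤ length T → ∀ i → ∃[ c ] c ∈ T × ℓ c ≡ i
    transversal-meets {T} M n≤ i
      with c , c∈ , i≡ ← ∈-map⁻ ℓ (surjective (map-line-unique M) (subst (n ≤_) (sym (length-map ℓ T)) n≤) i)
      = c , c∈ , sym i≡

    off : Fin n → Cells → Cells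
    off i = filter (λ c → ¬? (ℓ c Fin.≟ i))

    off-⊆ : ∀ {i S} → off i S ⊆ S
    off-⊆ {i} {S} = proj₁ ∘ ∈-filter⁻ (λ c → ¬? (ℓ c Fin.≟ i)) {xs = S}

    -- A matching has at most one cell on a line, and its remaining cells form a matching off that
    -- line.
    ν≤1+off : ∀ i S → ν S ≤ suc (ν (off i S))
    ν≤1+off i S with T , M , T⊆ , ≡ν ← ν-attained S = begin
      ν S                                      ≡⟨ sym ≡ν ⟩
      length T                                 ≡⟨ sym (length-filter-∁ on? T) ⟩
      length (filter on? T) + length (off i T) ≤⟨ ℕ.+-monoˡ-≤ _ atMostOne ⟩
      suc (length (off i T))                   ≤⟨ s≤s (length≤ν (off i S) (AllPairs.filter⁺ (¬? ∘ on?) M) off⊆off) ⟩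
      suc (ν (off i S))                        ∎
      where
      open ℕ.≤-Reasoning
      on? : Decidable (λ c → ℓ c ≡ i)
      on? c = ℓ c Fin.≟ i
      atMostOne : length (filter on? T) ≤ length (tt ∷ [])
      atMostOne = pigeonhole (λ c _ → c ∈ T × ℓ c ≡ i) {ys = tt ∷ []} (Unique.filter⁺ on? (Matching⇒Unique M))
        (All.tabulate (λ c∈ → here (∈-filter⁻ on? {xs = T} c∈)))
        (λ (p∈ , p≡) (q∈ , q≡) → Matching-line-injective M p∈ q∈ (trans p≡ (sym q≡)))
      off⊆off : off i T ⊆ off i S
      off⊆off c∈ with c∈T , c≢ ← ∈-filter⁻ (¬? ∘ on?) {xs = T} c∈ = ∈-filter⁺ (¬? ∘ on?) (T⊆ c∈T) c≢

  ν≤n : ∀ S → ν S ≤ n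
  ν≤n S with T , M , _ , ≡ν ← ν-attained S = subst (_≤ n) ≡ν (Matching⇒length≤ row-isLine M)

  ν-∷ : ∀ z S → ν (z ∷ S) ≤ suc (ν S)
  ν-∷ z S = ℕ.≤-trans (ν≤1+off row-isLine (row z) (z ∷ S)) (s≤s (ν-mono _ S off⊆S))
    where
    off⊆S : off row-isLine (row z) (z ∷ S) ⊆ S
    off⊆S c∈ with ∈-filter⁻ (λ c → ¬? (row c Fin.≟ row z)) {xs = z ∷ S} c∈
    ... | here refl , r≢r = contradiction refl r≢r
    ... | there c∈S , _   = c∈S

  -- The line i, which carries t and y, contributes at most one cell to a matching, and z at most
  -- one more.
  ν-two-on-line : ∀ {ℓ} (isLine : IsLine ℓ) {i z t y F} → ℓ t ≡ i → ℓ y ≡ i →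
                  ν (z ∷ t ∷ y ∷ F) ≤ 2 + ν (off isLine i F)
  ν-two-on-line {ℓ} isLine {i} {z} {t} {y} {F} t≡ y≡ =
    ℕ.≤-trans (ν≤1+off isLine i (z ∷ t ∷ y ∷ F)) (s≤s (ℕ.≤-trans (ν-mono _ (z ∷ off isLine i F) ⊆z∷) (ν-∷ z (off isLine i F))))
    where
    ⊆z∷ : off isLine i (z ∷ t ∷ y ∷ F) ⊆ z ∷ off isLine i F
    ⊆z∷ c∈ with ∈-filter⁻ (λ c → ¬? (ℓ c Fin.≟ i)) {xs = z ∷ t ∷ y ∷ F} c∈
    ... | here c≡z , _                    = here c≡z
    ... | there (here refl) , ≢i          = contradiction t≡ ≢i
    ... | there (there (here refl)) , ≢i  = contradiction y≡ ≢i
    ... | there (there (there c∈F)) , ≢i  = there (∈-filter⁺ (λ c → ¬? (ℓ c Fin.≟ i)) c∈F ≢i)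

  ν≡n : ∀ S → n ≤ ν S → ν S ≡ n
  ν≡n S = ℕ.≤-antisym (ν≤n S)

  permutation-injective : ∀ (π : Permutation′ n) {i j} → π ⟨$⟩ʳ i ≡ π ⟨$⟩ʳ j → i ≡ j
  permutation-injective π = Injection.injective (↔⇒↣ π)

  graph⊆⇒ν≡n : ∀ (π : Permutation′ n) S → (∀ i → (i , π ⟨$⟩ʳ i) ∈ S) → ν S ≡ n
  graph⊆⇒ν≡n π S π∈ = ν≡n S (subst (_≤ ν S) (length-tabulate {n = n} cell)
    (length≤ν S (AllPairs.tabulate⁺ (λ i≢j → i≢j , i≢j ∘ permutation-injective π)) ⊆S))
    where
    cell : Fin n → Cell
    cell i = i , π ⟨$⟩ʳ i
    ⊆S : tabulate cell ⊆ S
    ⊆S c∈ with i , refl ← ∈-tabulate⁻ {f = cell} c∈ = π∈ i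

  -- `remQuot` enumerates the n * n cells without repetition, and on a full board all of them would
  -- occur in `xs ++ os`.
  not-full : ∀ {xs os} → length xs + length os < n * n → ¬ BoardFull xs os
  not-full {xs} {os} few full = ℕ.<⇒≱ few (subst₂ _≤_ (length-tabulate {n = n * n} id) (length-++ xs)
    (pigeonhole (λ k c → remQuot {n} n k ≡ c) (Unique.allFin⁺ (n * n))
      (All.tabulate (λ {k} _ → taken (remQuot {n} n k)))
      (λ p q → Injection.injective (↔⇒↣ (Fin.*↔× {n} {n})) (trans p (sym q)))))
    where
    taken : ∀ c → c ∈ xs ++ os
    taken c with c ∈? xs | c ∈? os
    ... | yes c∈ | _      = ∈-++⁺ˡ c∈
    ... | no _   | yes c∈ = ∈-++⁺ʳ xs c∈
    ... | no c∉  | no c∉′ = contradiction (c∉ , c∉′) (full c)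

-- The opening and the tie-break

module _ {n : ℕ} where
  open Game n

  free? : ∀ xs os → Decidable (Free xs os)
  free? xs os c = ¬? (c ∈? xs) ×-dec ¬? (c ∈? os)

  openBlock? : ∀ xs → Decidable (OpenBlock xs)
  openBlock? xs c = All.all? (λ x → ¬? (row x Fin.≟ row c)) xs ×-dec All.all? (λ x → ¬? (col x Fin.≟ col c)) xs

  OpenBlock⇒∉ : ∀ {xs c} → OpenBlock xs c → c ∉ xs
  OpenBlock⇒∉ (r-open , _) c∈ = All.lookup r-open c∈ refl

  OpenBlock-∷⁻ : ∀ {x xs c} → OpenBlock (x ∷ xs) c → OpenBlock xs c
  OpenBlock-∷⁻ (r-open , c-open) = All.tail r-open , All.tail c-open

  Matching-∷ : ∀ {xs c} → Matching xs → OpenBlock xs c → Matching (c ∷ xs)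
  Matching-∷ M (r-open , c-open) = All.zipWith (λ (r≢ , c≢) → ≢-sym r≢ , ≢-sym c≢) (r-open , c-open) ∷ M

  can-complete? : ∀ xs os → (∃[ c ] Free xs os c × Completes c xs) ⊎ CannotComplete xs os
  can-complete? xs os
    with Fin.any? (λ i → Fin.any? (λ j → free? xs os (i , j) ×-dec (ν ((i , j) ∷ xs) ℕ.≟ n)))
  ... | yes (i , j , free , completes) = inj₁ ((i , j) , free , completes)
  ... | no  none = inj₂ (λ c free completes → none (row c , col c , free , completes))

  module _ (ℓ : Cell → Fin n) (xs : Cells) where

    openLines : List (Fin n)
    openLines = complement (map ℓ xs)

    ∈-openLines⁺ : ∀ {i} → All (λ x → ℓ x ≢ i) xs → i ∈ openLines
    ∈-openLines⁺ i-open = ∈-complement⁺ λ i∈ →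
      let _ , x∈ , i≡ = ∈-map⁻ ℓ i∈ in All.lookup i-open x∈ (sym i≡)

    ∈-openLines⁻ : ∀ {i} → i ∈ openLines → All (λ x → ℓ x ≢ i) xs
    ∈-openLines⁻ i∈ = All.tabulate λ { x∈ refl → ∈-complement⁻ {xs = map ℓ xs} i∈ (∈-map⁺ ℓ x∈) }

    openLines-unique : Unique openLines
    openLines-unique = complement-unique (map ℓ xs)

    length-openLines : IsLine ℓ → Matching xs → length xs + length openLines ≡ n
    length-openLines isLine M =
      trans (cong (_+ length openLines) (sym (length-map ℓ xs))) (length-complement (map-line-unique isLine M))

module _ {n : ℕ} where

  transpose-ˡ : ∀ (i j : Fin n) → transpose i j ⟨$⟩ʳ i ≡ j
  transpose-ˡ i j rewrite dec-true (i Fin.≟ i) refl = refl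

  transpose-ʳ : ∀ (i j : Fin n) → transpose i j ⟨$⟩ʳ j ≡ i
  transpose-ʳ i j with j Fin.≟ i
  ... | yes j≡i = j≡i
  ... | no  _ rewrite dec-true (j Fin.≟ j) refl = refl

  transpose-other : ∀ {i j k : Fin n} → k ≢ i → k ≢ j → transpose i j ⟨$⟩ʳ k ≡ k
  transpose-other {i} {j} {k} k≢i k≢j
    rewrite dec-false (k Fin.≟ i) k≢i | dec-false (k Fin.≟ j) k≢j = refl

opposite-≢ : (a : Fin 2) → opposite a ≢ a
opposite-≢ zero       ()
opposite-≢ (suc zero) ()

-- From here on n is `4 + m`, so n - 3, n - 2 and n - 1 are `1 + m`, `2 + m` and `3 + m`.
module _ {m : ℕ} where
  open Game (4 + m)

  -- The invariant of the opening. When X is to move it is claimed for `drop 1 os` only, because O's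
  -- latest stone may lie in the open block.
  Quiet : (xs os : Cells) → Set
  Quiet xs os = All (¬_ ∘ OpenBlock xs) os

  Quiet-∷ : ∀ {xs os} c → Quiet xs os → Quiet (c ∷ xs) os
  Quiet-∷ c = All.map (_∘ OpenBlock-∷⁻)

  -- Two lines are wanted because, when X must reply in the row of O's stone x, x itself may occupy
  -- that row's cell in the first open column.
  open-pair : ∀ {ℓ xs} → IsLine ℓ → Matching xs → length xs ≤ 2 + m →
              ∃₂ λ i j → i ≢ j × All (λ x → ℓ x ≢ i) xs × All (λ x → ℓ x ≢ j) xs
  open-pair {ℓ} {xs} isLine M few =
    let i , j , i≢j , i∈ , j∈ = two-members (openLines-unique ℓ xs) many
    in  i , j , i≢j , ∈-openLines⁻ ℓ xs i∈ , ∈-openLines⁻ ℓ xs j∈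
    where
    many : 2 ≤ length (openLines ℓ xs)
    many = ℕ.+-cancelˡ-≤ (2 + m) _ _ (begin
      2 + m + 2                          ≡⟨ ℕ.+-comm (2 + m) 2 ⟩
      4 + m                              ≡⟨ sym (length-openLines ℓ xs isLine M) ⟩
      length xs + length (openLines ℓ xs) ≤⟨ ℕ.+-monoˡ-≤ _ few ⟩
      2 + m + length (openLines ℓ xs)    ∎)
      where open ℕ.≤-Reasoning

  phase1-exists : ∀ {xs os} → length xs ≡ length os → length xs ≤ 2 + m → Matching xs →
                  Quiet xs (drop 1 os) → ∃[ c ] Phase1 xs os c
  phase1-exists {[]}     {[]}     len few M quiet = (zero , zero) , first
  phase1-exists {y ∷ xs} {x ∷ os} len few M quiet
    with r , _ , _ , r-open , _ ← open-pair row-isLine M few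
       | c , c′ , c≢c′ , c-open , c′-open ← open-pair col-isLine M few
    with openBlock? (y ∷ xs) x
  ... | no x∉H = (r , c) , outside x∉H H (OpenBlock⇒∉ H ,
                   λ { (here refl) → x∉H H ; (there ∈os) → All.lookup quiet ∈os H })
    where H = r-open , c-open
  ... | yes x∈H@(rx-open , _) with c Fin.≟ col x
  ...   | no c≢x = (row x , c) , inside x∈H H (OpenBlock⇒∉ H ,
                     λ { (here refl) → c≢x refl ; (there ∈os) → All.lookup quiet ∈os H }) refl
    where H = rx-open , c-open
  ...   | yes refl = (row x , c′) , inside x∈H H (OpenBlock⇒∉ H ,
                     λ { (here refl) → c≢c′ refl ; (there ∈os) → All.lookup quiet ∈os H }) refl
    where H = rx-open , c′-open

  phase1-free : ∀ {xs os c} → Phase1 xs os c → Free xs os c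
  phase1-free first                = (λ ()) , (λ ())
  phase1-free (inside _ _ free _)  = free
  phase1-free (outside _ _ free)   = free

  phase1-matching : ∀ {xs os c} → Matching xs → Phase1 xs os c → Matching (c ∷ xs)
  phase1-matching M first            = [] ∷ []
  phase1-matching M (inside _ H _ _) = Matching-∷ M H
  phase1-matching M (outside _ H _)  = Matching-∷ M H

  -- A reply in the row of x closes that row and so expels x from the open block; the block only
  -- shrinks, so the older O-stones stay outside it.
  phase1-quiet : ∀ {xs os c} → Quiet xs (drop 1 os) → Phase1 xs os c → Quiet (c ∷ xs) os
  phase1-quiet quiet first                     = []
  phase1-quiet quiet (inside _ _ _ same-row)   = (λ (r-open , _) → All.head r-open same-row) ∷ Quiet-∷ _ quiet
  phase1-quiet quiet (outside x∉H _ _)         = (x∉H ∘ OpenBlock-∷⁻) ∷ Quiet-∷ _ quiet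

  corners : ∀ {xs} → Matching xs → length xs ≡ 2 + m → Corners xs
  corners {xs} M len =
    let u , u-inj , u-open = enumerate₂ (openLines-unique row xs) (two row-isLine)
        v , v-inj , v-open = enumerate₂ (openLines-unique col xs) (two col-isLine)
    in record
      { u = u ; v = v ; u-inj = u-inj ; v-inj = v-inj
      ; u-open = λ r → mk⇔ (to (u-open r) ∘ ∈-openLines⁺ row xs) (∈-openLines⁻ row xs ∘ from (u-open r))
      ; v-open = λ c → mk⇔ (to (v-open c) ∘ ∈-openLines⁺ col xs) (∈-openLines⁻ col xs ∘ from (v-open c))
      }
    where
    open Equivalence
    two : ∀ {ℓ} → IsLine ℓ → length (openLines ℓ xs) ≡ 2
    two {ℓ} isLine = ℕ.+-cancelˡ-≡ (2 + m) _ _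
      (trans (cong (_+ length (openLines ℓ xs)) (sym len)) (trans (length-openLines ℓ xs isLine M) (ℕ.+-comm 2 (2 + m))))

  Cross : Row → Col → Cell → Set
  Cross b d f = row f ≡ b ⊎ col f ≡ d

  cross? : ∀ b d → Decidable (Cross b d)
  cross? b d f = (row f Fin.≟ b) ⊎-dec (col f Fin.≟ d)

  weight≡0 : ∀ {F b d} → weight F (b , d) ≡ 0 → OpenRow F b × OpenCol F d
  weight≡0 {F} {b} {d} w≡0 = All.map (_∘ inj₁) none , All.map (_∘ inj₂) none
    where
    none : All (¬_ ∘ Cross b d) F
    none = All.¬Any⇒All¬ F (λ some → ℕ.<⇒≢ (filter-some (cross? b d) some) (sym w≡0))

  module _ {xs : Cells} (k : Corners xs) {x : Cell} {F′ : Cells} (quiet : Quiet xs F′) (len : length F′ ≡ 1 + m) where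
    open Corners k
    private
      F = x ∷ F′

    corner-open : ∀ a c → OpenBlock xs (corner a c)
    corner-open a c = Equivalence.from (u-open _) (a , refl) , Equivalence.from (v-open _) (c , refl)

    -- `F′` is nonempty, and all its stones lie outside the open block.
    not-all-open : ¬ All (OpenBlock xs) F
    not-all-open (_ ∷ H) = clash quiet len H
      where
      clash : ∀ {G} → Quiet xs G → length G ≡ 1 + m → ¬ All (OpenBlock xs) G
      clash []       ()  _
      clash (¬h ∷ _) _   (h ∷ _) = ¬h h

    opposite-corner-involutive : ∀ a c → opposite-corner (opposite a) (opposite c) ≡ corner a c
    opposite-corner-involutive a c = cong₂ _,_ (cong u (Fin.opposite-involutive a)) (cong v (Fin.opposite-involutive c))

    corner-free : ∀ a c → corner a c ≢ x → Free xs F (corner a c)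
    corner-free a c ≢x = OpenBlock⇒∉ (corner-open a c) ,
      λ { (here ≡x) → ≢x ≡x ; (there ∈F′) → All.lookup quiet ∈F′ (corner-open a c) }

    corner-injective : ∀ {a c a′ c′} → corner a c ≡ corner a′ c′ → a ≡ a′ × c ≡ c′
    corner-injective eq = u-inj (cong row eq) , v-inj (cong col eq)

    -- `F` has n - 2 stones, so a weight above n - 3 counts every one of them.
    weight-small-or-all : ∀ b d → weight F (b , d) ≤ 1 + m ⊎ All (Cross b d) F
    weight-small-or-all b d with weight F (b , d) ≤? 1 + m
    ... | yes w≤ = inj₁ w≤
    ... | no  w≰ = inj₂ (filter-length≤⇒All (cross? b d) F (subst (_≤ weight F (b , d)) (cong suc (sym len)) (ℕ.≰⇒> w≰)))

    -- Only x can occupy a corner, so one of the two diagonals of the 2 × 2 block is entirely free.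
    admissible-exists : ∃₂ λ a c → Admissible k F a c
    admissible-exists with corner zero zero ≟ᶜ x | corner (suc zero) (suc zero) ≟ᶜ x
    ... | no ≢x | no ≢x′ = zero , zero , corner-free _ _ ≢x , corner-free _ _ ≢x′
    ... | yes refl | _   = zero , suc zero ,
      corner-free _ _ ((λ ()) ∘ proj₂ ∘ corner-injective) , corner-free _ _ ((λ ()) ∘ proj₁ ∘ corner-injective)
    ... | no _ | yes refl = zero , suc zero ,
      corner-free _ _ ((λ ()) ∘ proj₁ ∘ corner-injective) , corner-free _ _ ((λ ()) ∘ proj₂ ∘ corner-injective)

    opposite-crosses : ∀ a c {f} → Cross (u a) (v c) f → Cross (u (opposite a)) (v (opposite c)) f → OpenBlock xs f
    opposite-crosses a c (inj₁ refl) (inj₁ eq)   = contradiction (sym (u-inj eq)) (opposite-≢ a)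
    opposite-crosses a c (inj₁ refl) (inj₂ refl) = corner-open a (opposite c)
    opposite-crosses a c (inj₂ refl) (inj₁ refl) = corner-open (opposite a) c
    opposite-crosses a c (inj₂ refl) (inj₂ eq)   = contradiction (sym (v-inj eq)) (opposite-≢ c)

    eligible-exists : ∃₂ λ a c → Eligible k F a c
    eligible-exists with a , c , adm@(free , free′) ← admissible-exists
      with weight-small-or-all (u (opposite a)) (v (opposite c)) | weight-small-or-all (u a) (v c)
    ... | inj₁ w≤ | _       = a , c , adm , w≤
    -- X plays the opposite corner instead, which makes `corner a c` the outcome.
    ... | inj₂ _  | inj₁ w≤ = opposite a , opposite c ,
      (free′ , subst (Free xs F) (sym (opposite-corner-involutive a c)) free) ,
      subst (λ o → weight F o ≤ 1 + m) (sym (opposite-corner-involutive a c)) w≤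
    ... | inj₂ all  | inj₂ all′ = contradiction (All.zipWith (λ (p , q) → opposite-crosses a c q p) (all , all′)) not-all-open

    preferred? : ∀ a c → Dec (Preferred k F a c)
    preferred? a c = ((free? xs F (corner a c) ×-dec free? xs F (opposite-corner a c))
      ×-dec (weight F (opposite-corner a c) ≤? 1 + m)) ×-dec (1 ≤? weight F (opposite-corner a c))

    tieBreak-exists : ∃₂ λ a c → TieBreak k F a c
    tieBreak-exists with Fin.any? (λ a → Fin.any? (preferred? a))
    ... | yes (a , c , pref) = a , c , inj₁ pref
    ... | no  none = let a , c , elig = eligible-exists in
      a , c , inj₂ ((λ a′ c′ pref → none (a′ , c′ , pref)) , elig)

    tieBreak-eligible : ∀ {a c} → TieBreak k F a c → Eligible k F a c
    tieBreak-eligible (inj₁ (elig , _)) = elig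
    tieBreak-eligible (inj₂ (_ , elig)) = elig

    -- Stones confined to one line have `ν` at most 1, whereas n - 2 is at least 2.
    matching-spreads : ∀ {ℓ i} → IsLine ℓ → ν F ≡ 2 + m → ¬ All (λ f → ℓ f ≡ i) F
    matching-spreads {ℓ} {i} isLine νF all = ℕ.<⇒≱ (s≤s (s≤s z≤n)) (begin
      2 + m                        ≡⟨ sym νF ⟩
      ν F                          ≤⟨ ν≤1+off isLine i F ⟩
      suc (ν (off isLine i F))     ≤⟨ s≤s (ν≤length (off isLine i F)) ⟩
      suc (length (off isLine i F)) ≡⟨ cong (suc ∘ length) (filter-none (λ c → ¬? (ℓ c Fin.≟ i)) (All.map (λ eq ≢i → ≢i eq) all)) ⟩
      1                            ∎)
      where open ℕ.≤-Reasoning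

    -- Weight 0 means that X found no preferred outcome. All four corners turn out to be admissible,
    -- so every outcome has weight 0 or n - 2. For the two outcomes adjacent to (b , d) the second
    -- value would put all of `F` on a single line, against the size of `ν F`.
    tieBreak-weight0 : ∀ {a c} → TieBreak k F a c → weight F (opposite-corner a c) ≡ 0 → ν F ≡ 2 + m →
                       OpenRow F (u a) × OpenCol F (v c)
    tieBreak-weight0 (inj₁ (_ , 1≤w)) w≡0 νF = contradiction w≡0 (ℕ.>⇒≢ 1≤w)
    tieBreak-weight0 {a} {c} (inj₂ (none , ((free , free′) , _))) w≡0 νF = ua-open , vc-open
      where
      b = u (opposite a)
      d = v (opposite c)
      b-open = proj₁ (weight≡0 w≡0)
      d-open = proj₂ (weight≡0 w≡0)

      x≢corner : ∀ a′ c′ → corner a′ c′ ≢ x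
      -- A corner in row b or column d would give positive weight if x were there; the remaining
      -- corner is the free cell that X plays.
      x≢corner a′ c′ refl with a′ Fin.≟ opposite a | c′ Fin.≟ opposite c
      ... | yes refl | _ = All.head b-open refl
      ... | no _ | yes refl = All.head d-open refl
      ... | no a′≢ | no c′≢ = proj₂ free (here (cong₂ corner (only a a′ a′≢) (only c c′ c′≢)))
        where
        only : (e e′ : Fin 2) → e′ ≢ opposite e → e ≡ e′
        only zero       zero       _ = refl
        only zero       (suc zero) ≢ = contradiction refl ≢
        only (suc zero) zero       ≢ = contradiction refl ≢
        only (suc zero) (suc zero) _ = refl

      admissible : ∀ a′ c′ → Admissible k F a′ c′
      admissible a′ c′ = corner-free a′ c′ (x≢corner a′ c′) ,
        corner-free (opposite a′) (opposite c′) (x≢corner (opposite a′) (opposite c′))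

      weight-0-or-all : ∀ a′ c′ → weight F (opposite-corner a′ c′) ≡ 0 ⊎ All (Cross (u (opposite a′)) (v (opposite c′))) F
      weight-0-or-all a′ c′ with weight-small-or-all (u (opposite a′)) (v (opposite c′))
      ... | inj₂ all = inj₂ all
      ... | inj₁ w≤ with 1 ≤? weight F (opposite-corner a′ c′)
      ...   | yes 1≤w = contradiction ((admissible a′ c′ , w≤) , 1≤w) (none a′ c′)
      ...   | no  1≰w = inj₁ (ℕ.n<1⇒n≡0 (ℕ.≰⇒> 1≰w))

      ua-open : OpenRow F (u a)
      -- This is the outcome (u a , d). As column d is free of O-stones, full weight would put all
      -- of `F` in row u a.
      ua-open with weight-0-or-all (opposite a) c
      ... | inj₁ w≡0′ = subst (OpenRow F ∘ u) (Fin.opposite-involutive a) (proj₁ (weight≡0 w≡0′))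
      ... | inj₂ all  = contradiction
        (All.zipWith (λ { (inj₁ eq , _) → eq ; (inj₂ eq , ≢d) → contradiction eq ≢d }) (all , d-open))
        (matching-spreads row-isLine νF)

      vc-open : OpenCol F (v c)
      vc-open with weight-0-or-all a (opposite c)
      ... | inj₁ w≡0′ = subst (OpenCol F ∘ v) (Fin.opposite-involutive c) (proj₂ (weight≡0 w≡0′))
      ... | inj₂ all  = contradiction
        (All.zipWith (λ { (inj₁ eq , ≢b) → contradiction eq ≢b ; (inj₂ eq , _) → eq }) (all , b-open))
        (matching-spreads col-isLine νF)

  -- The position right after ply 2n - 3: x is X's move n - 1 and `M` holds the earlier X-stones.
  -- `head-open` keeps what the tie-break yields for the case w = 0, ν F = n - 2.
  record Outcome (x : Cell) (M F : Cells) (b : Row) (d : Col) : Set where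
    field
      length-M  : length M ≡ 2 + m
      length-F  : length F ≡ 2 + m
      matching  : Matching (x ∷ M)
      b-open    : OpenRow (x ∷ M) b
      d-open    : OpenCol (x ∷ M) d
      bd∉F      : (b , d) ∉ F
      weight≤   : weight F (b , d) ≤ 1 + m
      head-open : weight F (b , d) ≡ 0 → ν F ≡ 2 + m → OpenRow F (row x) × OpenCol F (col x)

  tieBreak-outcome : ∀ {xs F} (k : Corners xs) → Matching xs → Quiet xs (drop 1 F) →
                     length xs ≡ 2 + m → length F ≡ 2 + m → ∀ {a c} → TieBreak k F a c →
                     Outcome (Corners.corner k a c) xs F (Corners.u k (opposite a)) (Corners.v k (opposite c))
  tieBreak-outcome {xs} {x ∷ F} k M quiet len-xs len-F {a} {c} tb = record
    { length-M  = len-xs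
    ; length-F  = len-F
    ; matching  = Matching-∷ M (corner-open k {x} quiet len a c)
    ; b-open    = (opposite-≢ a ∘ sym ∘ u-inj) ∷ proj₁ (corner-open k {x} quiet len (opposite a) (opposite c))
    ; d-open    = (opposite-≢ c ∘ sym ∘ v-inj) ∷ proj₂ (corner-open k {x} quiet len (opposite a) (opposite c))
    ; bd∉F      = proj₂ (proj₂ (proj₁ eligible))
    ; weight≤   = proj₂ eligible
    ; head-open = tieBreak-weight0 k quiet len tb
    }
    where
    open Corners k
    len = ℕ.suc-injective len-F
    eligible = tieBreak-eligible k quiet len tb

-- The second phase

  weight≡0⁺ : ∀ {F b d} → OpenRow F b → OpenCol F d → weight F (b , d) ≡ 0
  weight≡0⁺ {F} {b} {d} b-open d-open =
    cong length (filter-none (cross? b d) {xs = F} (All.zipWith (λ (≢b , ≢d) → [ ≢b , ≢d ]′) (b-open , d-open)))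

  -- With (b , d) added, the matching becomes a transversal, which meets every row and every column
  -- once and so is the graph of a permutation.
  induced-permutation : ∀ {xs b d} → length xs ≡ 3 + m → Matching xs → OpenRow xs b → OpenCol xs d →
                        ∃[ σ ] Induces xs b d σ
  induced-permutation {xs} {b} {d} len M b-open d-open = σ , record
    { matching = M
    ; b↦d      = sym (functional (here refl))
    ; graph    = λ i j → mk⇔
        (λ ij∈ → (λ { refl → All.lookup b-open ij∈ refl }) , sym (functional (there ij∈)))
        (λ { (i≢b , refl) → stone i≢b (proj₂ (at-row i)) })
    }
    where
    T = (b , d) ∷ xs
    T-matching : Matching T
    T-matching = Matching-∷ M (b-open , d-open)

    at-row : ∀ i → ∃[ j ] (i , j) ∈ T
    at-row i with c , c∈ , refl ← transversal-meets row-isLine T-matching (ℕ.≤-reflexive (sym (cong suc len))) i = col c , c∈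

    at-col : ∀ j → ∃[ i ] (i , j) ∈ T
    at-col j with c , c∈ , refl ← transversal-meets col-isLine T-matching (ℕ.≤-reflexive (sym (cong suc len))) j = row c , c∈

    functional : ∀ {i j} → (i , j) ∈ T → j ≡ proj₁ (at-row i)
    functional {i} ij∈ = cong col (Matching-line-injective row-isLine T-matching ij∈ (proj₂ (at-row i)) refl)

    σ : Permutation′ (4 + m)
    σ = permutation (proj₁ ∘ at-row) (proj₁ ∘ at-col)
      (λ j → sym (functional (proj₂ (at-col j))))
      (λ i → cong row (Matching-line-injective col-isLine T-matching (proj₂ (at-col _)) (proj₂ (at-row i)) refl))

    stone : ∀ {i j} → i ≢ b → (i , j) ∈ T → (i , j) ∈ xs
    stone i≢b (here refl) = contradiction refl i≢b
    stone i≢b (there ∈xs) = ∈xs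

  -- The position after X's first plan move, which threatens t; q is the second plan move, after
  -- which both c₁ and c₂ complete. The fields about q, c₁, c₂ and `safe` already count t as an
  -- O-stone, since O has to answer there.
  record Pending (q : Cell) (xs os : Cells) : Set where
    field
      {t c₁ c₂}    : Cell
      length-xs    : length xs ≡ 4 + m
      length-os    : length os ≡ 3 + m
      t-free       : Free xs os t
      t-completes  : Completes t xs
      q-free       : Free xs (t ∷ os) q
      c₁≢c₂        : c₁ ≢ c₂
      c₁-free      : Free (q ∷ xs) (t ∷ os) c₁
      c₂-free      : Free (q ∷ xs) (t ∷ os) c₂
      c₁-completes : Completes c₁ (q ∷ xs)
      c₂-completes : Completes c₂ (q ∷ xs)
      safe         : ∀ z → z ∉ xs → ν (z ∷ t ∷ os) ≢ 4 + m

  fresh-pending : ∀ {p q xs os} t c₁ c₂ → length xs ≡ 3 + m → length os ≡ 3 + m →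
                  Unique (p ∷ t ∷ q ∷ c₁ ∷ c₂ ∷ []) → All (Free xs os) (p ∷ t ∷ q ∷ c₁ ∷ c₂ ∷ []) →
                  Completes t (p ∷ xs) → Completes c₁ (q ∷ p ∷ xs) → Completes c₂ (q ∷ p ∷ xs) →
                  (∀ z → z ∉ xs → ν (z ∷ t ∷ os) ≢ 4 + m) →
                  Pending q (p ∷ xs) os
  fresh-pending t c₁ c₂ len-xs len-os
    ((p≢t ∷ p≢q ∷ p≢c₁ ∷ p≢c₂ ∷ []) ∷ (t≢q ∷ t≢c₁ ∷ t≢c₂ ∷ []) ∷ (q≢c₁ ∷ q≢c₂ ∷ []) ∷ (c₁≢c₂ ∷ []) ∷ [] ∷ [])
    (p-free ∷ (t∉xs , t∉os) ∷ (q∉xs , q∉os) ∷ (c₁∉xs , c₁∉os) ∷ (c₂∉xs , c₂∉os) ∷ [])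
    t-completes c₁-completes c₂-completes safe = record
    { length-xs    = cong suc len-xs
    ; length-os    = len-os
    ; t-free       = ∉-∷ p≢t t∉xs , t∉os
    ; t-completes  = t-completes
    ; q-free       = ∉-∷ p≢q q∉xs , ∉-∷ t≢q q∉os
    ; c₁≢c₂        = c₁≢c₂
    ; c₁-free      = ∉-∷ q≢c₁ (∉-∷ p≢c₁ c₁∉xs) , ∉-∷ t≢c₁ c₁∉os
    ; c₂-free      = ∉-∷ q≢c₂ (∉-∷ p≢c₂ c₂∉xs) , ∉-∷ t≢c₂ c₂∉os
    ; c₁-completes = c₁-completes
    ; c₂-completes = c₂-completes
    ; safe         = λ z z∉ → safe z (z∉ ∘ there)
    }
    where
    ∉-∷ : ∀ {x c : Cell} {S} → x ≢ c → c ∉ S → c ∉ x ∷ S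
    ∉-∷ x≢c c∉ (here c≡x) = x≢c (sym c≡x)
    ∉-∷ x≢c c∉ (there c∈) = c∉ c∈

  -- The line i accounts for one cell, the at most n - 3 stones of `F` off it for one each, and z
  -- for one more: n - 1 in all.
  safe-on-line : ∀ {ℓ} → IsLine ℓ → ∀ {i z t y F} → ℓ t ≡ i → ℓ y ≡ i → length F ≡ 2 + m →
                 Any (λ f → ℓ f ≡ i) F → ν (z ∷ t ∷ y ∷ F) ≢ 4 + m
  safe-on-line {ℓ} isLine {i} {F = F} t≡ y≡ len meets = ℕ.<⇒≢ (s≤s (begin
    ν (_ ∷ _ ∷ _ ∷ F)              ≤⟨ ν-two-on-line isLine {F = F} t≡ y≡ ⟩
    2 + ν (off isLine i F)         ≤⟨ ℕ.+-monoʳ-≤ 2 (ν≤length (off isLine i F)) ⟩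
    2 + length (off isLine i F)    ≤⟨ s≤s (filter-notAll (λ c → ¬? (ℓ c Fin.≟ i)) F (Any.map (λ eq ≢i → ≢i eq) meets)) ⟩
    1 + length F                   ≡⟨ cong suc len ⟩
    3 + m                          ∎))
    where open ℕ.≤-Reasoning

  -- The column of t and y gives one cell, z another and `F` at most n - 3: again n - 1 in all.
  safe-small : ∀ {z t y F} → col t ≡ col y → ν F ≤ 1 + m → ν (z ∷ t ∷ y ∷ F) ≢ 4 + m
  safe-small {F = F} t≡ small = ℕ.<⇒≢ (s≤s (ℕ.≤-trans (ν-two-on-line col-isLine {F = F} t≡ refl)
    (s≤s (s≤s (ℕ.≤-trans (ν-mono _ F (off-⊆ col-isLine {S = F})) small)))))

  -- A transversal could meet the two lines of x only in z, hence z = x.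
  safe-large : ∀ {x z t y F} → OpenRow F (row x) → OpenCol F (col x) → row t ≢ row x → row y ≢ row x →
               col t ≢ col x → col y ≢ col x → z ≢ x → ν (z ∷ t ∷ y ∷ F) ≢ 4 + m
  safe-large {x} {z} {t} {y} {F} row-open col-open t≢r y≢r t≢c y≢c z≢x ν≡ =
    z≢x (cong₂ _,_ (on row-isLine row-open t≢r y≢r) (on col-isLine col-open t≢c y≢c))
    where
    on : ∀ {ℓ} → IsLine ℓ → All (λ f → ℓ f ≢ ℓ x) F → ℓ t ≢ ℓ x → ℓ y ≢ ℓ x → ℓ z ≡ ℓ x
    on {ℓ} isLine ℓ-open t≢ y≢ with T , M , T⊆ , ≡ν ← ν-attained (z ∷ t ∷ y ∷ F)
      with c , c∈ , eq ← transversal-meets isLine M (ℕ.≤-reflexive (sym (trans ≡ν ν≡))) (ℓ x) with T⊆ c∈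
    ... | here refl                 = eq
    ... | there (here refl)         = contradiction eq t≢
    ... | there (there (here refl)) = contradiction eq y≢
    ... | there (there (there c∈F)) = contradiction eq (All.lookup ℓ-open c∈F)

  module _ {xs F : Cells} {ua b : Row} {σ : Permutation′ (4 + m)} (ind : Induces xs b (σ ⟨$⟩ʳ b) σ) where
    open Induces ind
    open Phase2 xs F ua b (σ ⟨$⟩ʳ b) σ

    private
      -- Columns are named by rows through σ: X's stones are the diagonal cells except `cell b b`,
      -- which is (b , d); `cell s b` is (s , d), and `cell r s` is a cross cell.
      cell : Row → Row → Cell
      cell i j = i , σ ⟨$⟩ʳ j

    row≢ : ∀ {i j k l} → i ≢ k → cell i j ≢ cell k l
    row≢ i≢k eq = i≢k (cong row eq)

    col≢ : ∀ {i j k l} → j ≢ l → cell i j ≢ cell k l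
    col≢ j≢l eq = j≢l (permutation-injective σ (cong col eq))

    diagonal∈xs : ∀ {i} → i ≢ b → cell i i ∈ xs
    diagonal∈xs i≢b = Equivalence.from (graph _ _) (i≢b , refl)

    off-diagonal∉xs : ∀ {i j} → i ≢ j → cell i j ∉ xs
    off-diagonal∉xs i≢j ∈xs = i≢j (permutation-injective σ (proj₂ (Equivalence.to (graph _ _) ∈xs)))

    live : ∀ {s} → s ≢ b → cell s b ∉ F → cell b s ∉ F → Live s
    live s≢b sb∉F bs∉F = s≢b , (off-diagonal∉xs s≢b , sb∉F) , (off-diagonal∉xs (≢-sym s≢b) , bs∉F)

    live? : Decidable Live
    live? s = ¬? (s Fin.≟ b) ×-dec free? xs F _ ×-dec free? xs F _

    admissible? : ∀ r s → Dec (Admissible-i r s)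
    admissible? r s = live? r ×-dec live? s ×-dec ¬? (r Fin.≟ s) ×-dec free? xs F _

    -- Relates each row that is of no use for an admissible pair to a stone of O
    -- responsible for that, in such a way that the stone determines the row.
    Blocks : Row → Cell → Set
    Blocks i f = i ≢ b × (f ≡ cell i b ⊎ col f ≡ σ ⟨$⟩ʳ i)

    -- A stone in column d can block only its own row; any other stone blocks the row that σ sends
    -- to its column.
    Blocks-injective : ∀ {i i′ f} → Blocks i f → Blocks i′ f → i ≡ i′
    Blocks-injective (_ , inj₁ refl)  (_ , inj₁ eq)    = cong row eq
    Blocks-injective (_ , inj₁ refl)  (i′≢b , inj₂ eq) = contradiction (permutation-injective σ (sym eq)) i′≢b
    Blocks-injective (i≢b , inj₂ eq)  (_ , inj₁ refl)  = contradiction (permutation-injective σ (sym eq)) i≢b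
    Blocks-injective (_ , inj₂ eq)    (_ , inj₂ eq′)   = permutation-injective σ (trans (sym eq) eq′)

    private
      others : List Row
      others = complement (b ∷ [])

      others-unique : Unique others
      others-unique = complement-unique (b ∷ [])

      ∈-others : ∀ {i} → i ∈ others → i ≢ b
      ∈-others i∈ i≡b = ∈-complement⁻ {xs = b ∷ []} i∈ (here i≡b)

      length-others : length others ≡ 3 + m
      length-others = ℕ.suc-injective (length-complement ([] ∷ []))

    dead⇒blocked : ∀ {i} → i ≢ b → ¬ Live i → ∃[ f ] f ∈ F × Cross b (σ ⟨$⟩ʳ b) f × Blocks i f
    dead⇒blocked {i} i≢b dead with cell i b ∈? F | cell b i ∈? F
    ... | yes ib∈ | _       = cell i b , ib∈ , inj₂ refl , i≢b , inj₁ refl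
    ... | no _    | yes bi∈ = cell b i , bi∈ , inj₁ refl , i≢b , inj₂ refl
    ... | no ib∉  | no bi∉  = contradiction (live i≢b ib∉ bi∉) dead

    -- Distinct dead rows are blocked by distinct stones in row b or column d, so at most n - 3 of
    -- the n - 1 rows other than b are dead.
    live-pair : weight F (b , σ ⟨$⟩ʳ b) ≤ 1 + m → ∃₂ λ r s → r ≢ s × Live r × Live s
    live-pair w≤ =
      let r , s , r≢s , r∈ , s∈ = two-members (Unique.filter⁺ live? others-unique) many
      in r , s , r≢s , proj₂ (∈-filter⁻ live? {xs = others} r∈) , proj₂ (∈-filter⁻ live? {xs = others} s∈)
      where
      dead = filter (¬? ∘ live?) others
      few-dead : length dead ≤ 1 + m
      few-dead = ℕ.≤-trans (pigeonhole Blocks (Unique.filter⁺ (¬? ∘ live?) others-unique) (All.tabulate blocked) Blocks-injective) w≤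
        where
        blocked : ∀ {i} → i ∈ dead → Any (Blocks i) (filter (cross? b (σ ⟨$⟩ʳ b)) F)
        blocked i∈ with i∈′ , ¬live ← ∈-filter⁻ (¬? ∘ live?) {xs = others} i∈
          with f , f∈ , cross , blocks ← dead⇒blocked (∈-others i∈′) ¬live =
          lose (∈-filter⁺ (cross? b (σ ⟨$⟩ʳ b)) f∈ cross) blocks
      many : 2 ≤ length (filter live? others)
      many = ℕ.+-cancelʳ-≤ (1 + m) _ _ (begin
        2 + (1 + m)                                ≡⟨ sym length-others ⟩
        length others                              ≡⟨ sym (length-filter-∁ live? others) ⟩
        length (filter live? others) + length dead ≤⟨ ℕ.+-monoʳ-≤ _ few-dead ⟩
        length (filter live? others) + (1 + m)     ∎)
        where open ℕ.≤-Reasoning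

    -- Without such a pair, all cross cells between live rows are taken. Then a live row i other
    -- than r₀ is blocked by (r₀ , σ i), r₀ itself by (s₀ , σ r₀), and dead rows as before: n - 1
    -- rows blocked by n - 2 stones.
    admissible-pair : length F ≡ 2 + m → weight F (b , σ ⟨$⟩ʳ b) ≤ 1 + m → ∃₂ Admissible-i
    admissible-pair len w≤ with Fin.any? (λ r → Fin.any? (admissible? r))
    ... | yes pair = pair
    ... | no  none with r₀ , s₀ , r₀≢s₀ , r₀-live , s₀-live ← live-pair w≤ =
      contradiction (pigeonhole Blocks others-unique (All.tabulate (blocked ∘ ∈-others)) Blocks-injective)
        (ℕ.<⇒≱ (subst₂ _<_ (sym len) (sym length-others) ℕ.≤-refl))
      where
      taken : ∀ {r s} → Live r → Live s → r ≢ s → cell r s ∈ F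
      taken r-live s-live r≢s = decidable-stable (_ ∈? F)
        (λ rs∉F → none (_ , _ , r-live , s-live , r≢s , off-diagonal∉xs r≢s , rs∉F))
      blocked : ∀ {i} → i ≢ b → Any (Blocks i) F
      blocked {i} i≢b with live? i | i Fin.≟ r₀
      ... | no dead   | _        = let f , f∈ , _ , blocks = dead⇒blocked i≢b dead in lose f∈ blocks
      ... | yes _     | yes refl = lose (taken s₀-live r₀-live (≢-sym r₀≢s₀)) (i≢b , inj₂ refl)
      ... | yes live₁ | no i≢r₀  = lose (taken r₀-live live₁ (≢-sym i≢r₀)) (i≢b , inj₂ refl)

    module _ {S : Cells} (xs⊆S : xs ⊆ S) where

      private
        at : ∀ {i j k} → j ≡ k → cell i k ∈ S → cell i j ∈ S
        at refl ∈S = ∈S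

      -- X's stone in row i is traded for the cells (b , σ i) and (i , d).
      swap-completes : ∀ {i} → i ≢ b → cell b i ∈ S → cell i b ∈ S → ν S ≡ 4 + m
      swap-completes {i} i≢b bi∈ ib∈ = graph⊆⇒ν≡n (transpose b i ∘ₚ σ) S covered
        where
        covered : ∀ k → cell k (transpose b i ⟨$⟩ʳ k) ∈ S
        covered k = by (k Fin.≟ b) (k Fin.≟ i)
          where
          by : Dec (k ≡ b) → Dec (k ≡ i) → cell k (transpose b i ⟨$⟩ʳ k) ∈ S
          by (yes refl) _          = at (transpose-ˡ b i) bi∈
          by (no _)     (yes refl) = at (transpose-ʳ b i) ib∈
          by (no k≢b)   (no k≢i)   = at (transpose-other k≢b k≢i) (xs⊆S (diagonal∈xs k≢b))

      -- The product of the two transpositions is the 3-cycle b, i, j; it trades X's stones in rows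
      -- i and j for the three listed cells.
      cycle-completes : ∀ {i j} → i ≢ b → j ≢ b → i ≢ j → cell b i ∈ S → cell i j ∈ S → cell j b ∈ S → ν S ≡ 4 + m
      cycle-completes {i} {j} i≢b j≢b i≢j bi∈ ij∈ jb∈ = graph⊆⇒ν≡n (transpose b i ∘ₚ transpose b j ∘ₚ σ) S covered
        where
        covered : ∀ k → cell k (transpose b j ⟨$⟩ʳ (transpose b i ⟨$⟩ʳ k)) ∈ S
        covered k = by (k Fin.≟ b) (k Fin.≟ i) (k Fin.≟ j)
          where
          then : ∀ l {l′ l″} → transpose b i ⟨$⟩ʳ l ≡ l′ → transpose b j ⟨$⟩ʳ l′ ≡ l″ →
                 transpose b j ⟨$⟩ʳ (transpose b i ⟨$⟩ʳ l) ≡ l″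
          then l eq = trans (cong (transpose b j ⟨$⟩ʳ_) eq)
          by : Dec (k ≡ b) → Dec (k ≡ i) → Dec (k ≡ j) → cell k (transpose b j ⟨$⟩ʳ (transpose b i ⟨$⟩ʳ k)) ∈ S
          by (yes refl) _          _          = at (then b (transpose-ˡ b i) (transpose-other i≢b i≢j)) bi∈
          by (no _)     (yes refl) _          = at (then i (transpose-ʳ b i) (transpose-ˡ b j)) ij∈
          by (no k≢b)   (no k≢i)   (yes refl) = at (then k (transpose-other k≢b k≢i) (transpose-ʳ b j)) jb∈
          by (no k≢b)   (no k≢i)   (no k≢j)   =
            at (then k (transpose-other k≢b k≢i) (transpose-other k≢b k≢j)) (xs⊆S (diagonal∈xs k≢b))

    -- The cross cell of r and row x lies in the column of x, which `F` misses; row x is live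
    -- because `F` also misses row x and row b.
    head-pair : ∀ {x r} → x ∈ xs → OpenRow F b → OpenCol F (σ ⟨$⟩ʳ b) → OpenRow F (row x) → OpenCol F (col x) →
                Live r → r ≢ row x → Admissible-i r (row x)
    head-pair {x} {r} x∈ b-open d-open row-open col-open r-live r≢ =
      r-live , live s≢b (misses-row row-open) (misses-row b-open) , r≢ , off-diagonal∉xs r≢ ,
      (λ ∈F → All.lookup col-open ∈F σs≡)
      where
      s≢b = proj₁ (Equivalence.to (graph _ _) x∈)
      σs≡ = proj₂ (Equivalence.to (graph _ _) x∈)
      misses-row : ∀ {i j} → OpenRow F i → cell i j ∉ F
      misses-row i-open ∈F = All.lookup i-open ∈F refl

    module _ {r s} (len-xs : length xs ≡ 3 + m) (len-F : length F ≡ 2 + m) (bb∉F : cell b b ∉ F)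
             (adm : Admissible-i r s) where

      private
        r≢b = proj₁ (proj₁ adm)
        s≢b = proj₁ (proj₁ (proj₂ adm))
        r≢s = proj₁ (proj₂ (proj₂ adm))

        free′ : ∀ {c} → c ≢ cell b b → Free xs F c → Free xs (cell b b ∷ F) c
        free′ c≢bb (c∉xs , c∉F) = c∉xs , λ { (here c≡bb) → c≢bb c≡bb ; (there c∈F) → c∉F c∈F }

        rb-free : Free xs (cell b b ∷ F) (cell r b)
        rb-free = free′ (row≢ r≢b) (proj₁ (proj₂ (proj₁ adm)))
        br-free : Free xs (cell b b ∷ F) (cell b r)
        br-free = free′ (col≢ r≢b) (proj₂ (proj₂ (proj₁ adm)))
        sb-free : Free xs (cell b b ∷ F) (cell s b)
        sb-free = free′ (row≢ s≢b) (proj₁ (proj₂ (proj₁ (proj₂ adm))))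
        bs-free : Free xs (cell b b ∷ F) (cell b s)
        bs-free = free′ (col≢ s≢b) (proj₂ (proj₂ (proj₁ (proj₂ adm))))
        rs-free : Free xs (cell b b ∷ F) (cell r s)
        rs-free = free′ (row≢ r≢b) (proj₂ (proj₂ (proj₂ adm)))

      -- After (b , σ r) the threat is (r , d), by a swap. After (s , d) X threatens (b , σ s), by a
      -- swap, and the cross cell (r , σ s), by a 3-cycle. Plan (ii) plays the same two cells in
      -- reverse order, which exchanges the roles of (r , d) and (b , σ s).
      plan-i-pending : (∀ z → z ∉ xs → ν (z ∷ cell r b ∷ cell b b ∷ F) ≢ 4 + m) →
                       Free xs (cell b b ∷ F) (cell b r) × Pending (cell s b) (cell b r ∷ xs) (cell b b ∷ F)
      plan-i-pending safe = br-free , fresh-pending (cell r b) (cell b s) (cell r s) len-xs (cong suc len-F)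
        ((row≢ (≢-sym r≢b) ∷ row≢ (≢-sym s≢b) ∷ col≢ r≢s ∷ row≢ (≢-sym r≢b) ∷ []) ∷
         (row≢ r≢s ∷ row≢ r≢b ∷ col≢ (≢-sym s≢b) ∷ []) ∷
         (row≢ s≢b ∷ row≢ (≢-sym r≢s) ∷ []) ∷
         (row≢ (≢-sym r≢b) ∷ []) ∷ [] ∷ [])
        (br-free ∷ rb-free ∷ sb-free ∷ bs-free ∷ rs-free ∷ [])
        (swap-completes (there ∘ there) r≢b (there (here refl)) (here refl))
        (swap-completes (there ∘ there ∘ there) s≢b (here refl) (there (here refl)))
        (cycle-completes (there ∘ there ∘ there) r≢b s≢b r≢s (there (there (here refl))) (here refl) (there (here refl))) safe

      -- Plan (ii) for the pair (s , r).
      plan-ii-pending : (∀ z → z ∉ xs → ν (z ∷ cell b s ∷ cell b b ∷ F) ≢ 4 + m) →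
                        Free xs (cell b b ∷ F) (cell s b) × Pending (cell b r) (cell s b ∷ xs) (cell b b ∷ F)
      plan-ii-pending safe = sb-free , fresh-pending (cell b s) (cell r b) (cell r s) len-xs (cong suc len-F)
        ((row≢ s≢b ∷ row≢ s≢b ∷ row≢ (≢-sym r≢s) ∷ row≢ (≢-sym r≢s) ∷ []) ∷
         (col≢ (≢-sym r≢s) ∷ row≢ (≢-sym r≢b) ∷ row≢ (≢-sym r≢b) ∷ []) ∷
         (row≢ (≢-sym r≢b) ∷ row≢ (≢-sym r≢b) ∷ []) ∷
         (col≢ (≢-sym s≢b) ∷ []) ∷ [] ∷ [])
        (sb-free ∷ bs-free ∷ br-free ∷ rb-free ∷ rs-free ∷ [])
        (swap-completes (there ∘ there) s≢b (here refl) (there (here refl)))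
        (swap-completes (there ∘ there ∘ there) r≢b (there (here refl)) (here refl))
        (cycle-completes (there ∘ there ∘ there) r≢b s≢b r≢s (there (here refl)) (here refl) (there (there (here refl)))) safe

  -- After the tie-break (b , d) is free and completes X's matching, so only a stone on it leaves X
  -- without a completing cell.
  forced : ∀ {x M F b d y} → Outcome x M F b d → CannotComplete (x ∷ M) (y ∷ F) → y ≡ (b , d)
  forced {x} {M} {F} {b} {d} {y} o cannot with (b , d) ≟ᶜ y
  ... | yes bd≡y = sym bd≡y
  ... | no  bd≢y = contradiction
    (let σ , ind = induced-permutation (cong suc length-M) matching b-open d-open
     in  graph⊆⇒ν≡n σ ((b , d) ∷ x ∷ M) (covered ind))
    (cannot (b , d) (OpenBlock⇒∉ (b-open , d-open) , λ { (here bd≡y) → bd≢y bd≡y ; (there ∈F) → bd∉F ∈F }))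
    where
    open Outcome o
    covered : ∀ {σ} → Induces (x ∷ M) b d σ → ∀ i → (i , σ ⟨$⟩ʳ i) ∈ (b , d) ∷ x ∷ M
    covered ind i with i Fin.≟ b
    ... | yes refl = here (cong (i ,_) (Induces.b↦d ind))
    ... | no  i≢b  = there (Equivalence.from (Induces.graph ind _ _) (i≢b , refl))

  ν≰⇒maximal : ∀ F → length F ≡ 2 + m → ¬ ν F ≤ 1 + m → ν F ≡ 2 + m
  ν≰⇒maximal F len ν≰ = ℕ.≤-antisym (subst (ν F ≤_) len (ν≤length F)) (ℕ.≰⇒> ν≰)

  plan-exists : ∀ {x M F b d σ} → Outcome x M F b d → Induces (x ∷ M) b d σ →
                ∃₂ (Phase2.Plan (x ∷ M) F (row x) b d σ)
  plan-exists {x} {M} {F} {b} {d} {σ} o ind with refl ← Induces.b↦d ind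
    with Any.any? (λ f → col f Fin.≟ d) F | Any.any? (λ f → row f Fin.≟ b) F
       | admissible-pair {ua = row x} ind (Outcome.length-F o) (Outcome.weight≤ o)
  ... | yes meets-c | _ | _ , _ , adm = _ , _ , Phase2.meets-col meets-c adm
  -- The pair is reversed: plan (ii) tests the cross cell of the pair in the other order.
  ... | no ¬c | yes meets-r | _ , _ , (r-live , s-live , r≢s , rs-free) =
    _ , _ , Phase2.meets-row ¬c meets-r (s-live , r-live , ≢-sym r≢s , rs-free)
  ... | no ¬c | no ¬r | r , s , adm@(r-live , s-live , r≢s , _) with ν F ≤? 1 + m
  ...   | yes small = _ , _ , Phase2.meets-none-small ¬c ¬r small adm
  ...   | no  large with r Fin.≟ row x
  ...     | no  r≢x  = _ , _ , Phase2.meets-none-large ¬c ¬r (ν≰⇒maximal F (Outcome.length-F o) large) r-live r≢x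
  -- Of two distinct live rows at least one differs from row x.
  ...     | yes refl = _ , _ , Phase2.meets-none-large ¬c ¬r (ν≰⇒maximal F (Outcome.length-F o) large) s-live (≢-sym r≢s)

  -- O's two forced stones share column d under plan (i) and row b under plan (ii); the plan is
  -- chosen so that, where possible, `F` meets that line too. The two w = 0 cases use `safe-small`
  -- and `safe-large`.
  plan-pending : ∀ {x M F b d σ p q} → Outcome x M F b d → Induces (x ∷ M) b d σ →
                 Phase2.Plan (x ∷ M) F (row x) b d σ p q →
                 Free (x ∷ M) ((b , d) ∷ F) p × Pending q (p ∷ x ∷ M) ((b , d) ∷ F)
  plan-pending {x} {M} {F} {b} {d} {σ} o ind pl with refl ← Induces.b↦d ind = go pl
    where
    open Outcome o
    go : ∀ {p q} → Phase2.Plan (x ∷ M) F (row x) b d σ p q →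
         Free (x ∷ M) ((b , d) ∷ F) p × Pending q (p ∷ x ∷ M) ((b , d) ∷ F)
    go (Phase2.meets-col meets adm) = plan-i-pending {ua = row x} ind (cong suc length-M) length-F bd∉F adm
      (λ _ _ → safe-on-line col-isLine refl refl length-F meets)
    go (Phase2.meets-row _ meets (r-live , s-live , r≢s , sr-free)) =
      plan-ii-pending {ua = row x} ind (cong suc length-M) length-F bd∉F (s-live , r-live , ≢-sym r≢s , sr-free)
        (λ _ _ → safe-on-line row-isLine refl refl length-F meets)
    go (Phase2.meets-none-small _ _ small adm) =
      plan-i-pending {ua = row x} ind (cong suc length-M) length-F bd∉F adm (λ _ _ → safe-small {F = F} refl small)
    go (Phase2.meets-none-large ¬c ¬r νF r-live r≢x) =
      plan-i-pending {ua = row x} ind (cong suc length-M) length-F bd∉F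
        (head-pair {ua = row x} ind (here refl) row-b col-d row-x col-x r-live r≢x)
        (λ z z∉ → safe-large row-x col-x r≢x (≢-sym (All.head b-open)) (≢-sym (All.head d-open)) (≢-sym (All.head d-open))
                    (λ { refl → z∉ (here refl) }))
      where
      row-b = All.¬Any⇒All¬ F ¬r
      col-d = All.¬Any⇒All¬ F ¬c
      row-x = proj₁ (head-open (weight≡0⁺ row-b col-d) νF)
      col-x = proj₂ (head-open (weight≡0⁺ row-b col-d) νF)

-- The invariant of play

  Safe : (xs os : Cells) → Set
  Safe xs os = ∀ z → z ∉ xs → ν (z ∷ os) ≢ 4 + m

  record Double (xs os : Cells) : Set where
    field
      {c₁ c₂}      : Cell
      c₁≢c₂        : c₁ ≢ c₂
      c₁-free      : Free xs os c₁
      c₂-free      : Free xs os c₂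
      c₁-completes : Completes c₁ xs
      c₂-completes : Completes c₂ xs

  -- What is known of a reachable position for each memory. After a deviation X has already won,
  -- whatever the memory, hence the single constructor `won` with O nominally to move.
  data State : Player → Memory → (xs os : Cells) → Set where
    opening-X  : ∀ {xs os} → length xs ≡ length os → length xs ≤ 2 + m → Matching xs → Quiet xs (drop 1 os) →
                 State X opening xs os
    opening-O  : ∀ {xs os} → length xs ≡ suc (length os) → length xs ≤ 2 + m → Matching xs → Quiet xs os →
                 State O opening xs os
    outcome-O  : ∀ {x M F b d} → Outcome x M F b d → State O (outcome b d) (x ∷ M) F
    outcome-X  : ∀ {x M y F b d} → Outcome x M F b d → State X (outcome b d) (x ∷ M) (y ∷ F)
    pending-O  : ∀ {q xs os} → Pending q xs os → State O (pending q) xs os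
    pending-X  : ∀ {q xs y os} → Pending q xs os → y ∉ xs → State X (pending q) xs (y ∷ os)
    finished-O : ∀ {xs os} → length xs ≡ 5 + m → length os ≡ 4 + m → Double xs os → Safe xs os →
                 State O finished xs os
    finished-X : ∀ {xs y os} → length xs ≡ 5 + m → length os ≡ 4 + m → Double xs os → Safe xs os → y ∉ xs →
                 State X finished xs (y ∷ os)
    won        : ∀ {p xs os} → ν xs ≡ 4 + m → State O p xs os

  answered : ∀ {q xs os y} (P : Pending q xs os) → CannotComplete xs (y ∷ os) → y ≡ Pending.t P
  answered {y = y} P cannot with Pending.t P ≟ᶜ y
  ... | yes t≡y = sym t≡y
  ... | no  t≢y = contradiction t-completes (cannot t (proj₁ t-free ,
      λ { (here t≡y) → t≢y t≡y ; (there t∈) → proj₂ t-free t∈ }))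
    where open Pending P

  step-X : ∀ {p p′ xs os c} → State X p xs os → Prescribes p xs os c p′ → State O p′ (c ∷ xs) os
  step-X _ (deviate _ _ completes) = won completes
  step-X (opening-X len _ M quiet) (phase1 few move) =
    opening-O (cong suc len) few (phase1-matching M move) (phase1-quiet quiet move)
  step-X (opening-X len _ M quiet) (tieBreak len-xs k tb) =
    outcome-O (tieBreak-outcome k M quiet len-xs′ (trans (sym len) len-xs′) tb)
    where len-xs′ = ℕ.suc-injective len-xs
  step-X (outcome-X o) (plan cannot σ ind pl) with refl ← forced o cannot = pending-O (proj₂ (plan-pending o ind pl))
  step-X (pending-X P _) (continue cannot) with refl ← answered P cannot =
    finished-O (cong suc length-xs) (cong suc length-os)
      (record { c₁≢c₂ = c₁≢c₂ ; c₁-free = c₁-free ; c₂-free = c₂-free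
              ; c₁-completes = c₁-completes ; c₂-completes = c₂-completes })
      (λ z z∉ → safe z (z∉ ∘ there))
    where open Pending P

  step-O : ∀ {p xs os c} → State O p xs os → ¬ Over xs os → Free xs os c → State X p xs (c ∷ os)
  step-O (opening-O len few M quiet) _ _ = opening-X len few M quiet
  step-O (outcome-O o) _ _ = outcome-X o
  step-O (pending-O P) _ free = pending-X P (proj₁ free)
  step-O (finished-O len len′ D safe) _ free = finished-X len len′ D safe (proj₁ free)
  step-O (won ν≡) ¬over _ = contradiction (inj₁ ν≡) ¬over

  reachable⇒state : ∀ {t p xs os} → Reachable t p xs os → State t p xs os
  reachable⇒state start                 = opening-X refl z≤n [] []
  reachable⇒state (moveX r _ move _)    = step-X (reachable⇒state r) move
  reachable⇒state (moveO r ¬over free)  = step-O (reachable⇒state r) ¬over free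

  prescribed-free : ∀ {p p′ xs os c} → State X p xs os → Prescribes p xs os c p′ → Free xs os c
  prescribed-free _ (deviate _ free _) = free
  prescribed-free (opening-X _ _ _ _) (phase1 _ move) = phase1-free move
  prescribed-free {os = []} (opening-X len _ _ _) (tieBreak len-xs _ _) with () ← trans (sym len) (ℕ.suc-injective len-xs)
  prescribed-free {os = _ ∷ _} (opening-X len _ _ quiet) (tieBreak len-xs k tb) =
    proj₁ (proj₁ (tieBreak-eligible k quiet (ℕ.suc-injective (trans (sym len) (ℕ.suc-injective len-xs))) tb))
  prescribed-free (outcome-X o) (plan cannot σ ind pl) with refl ← forced o cannot = proj₁ (plan-pending o ind pl)
  prescribed-free (pending-X P _) (continue cannot) with refl ← answered P cannot = Pending.q-free P

  move-exists : ∀ {p xs os} → State X p xs os → ∃[ c ] ∃[ p′ ] Prescribes p xs os c p′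
  move-exists {xs = xs} {os} (opening-X len few M quiet) with suc (length xs) ≤? 2 + m
  ... | yes early = let c , move = phase1-exists len few M quiet in c , opening , phase1 early move
  ... | no  late  = tie os len quiet
    where
    len-xs = ℕ.≤-antisym few (ℕ.≤-pred (ℕ.≰⇒> late))
    tie : ∀ os → length xs ≡ length os → Quiet xs (drop 1 os) → ∃[ c ] ∃[ p′ ] Prescribes opening xs os c p′
    tie []       len quiet with () ← trans (sym len-xs) len
    tie (x ∷ os) len quiet =
      let k = corners M len-xs
          a , c , tb = tieBreak-exists k quiet (ℕ.suc-injective (trans (sym len) len-xs))
      in  _ , _ , tieBreak (cong suc len-xs) k tb
  move-exists {xs = xs} {os} (outcome-X o) with can-complete? xs os
  ... | inj₁ (c , free , completes) = c , _ , deviate outcome free completes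
  ... | inj₂ cannot =
    let σ , ind = induced-permutation (cong suc length-M) matching b-open d-open
        p , q , pl = plan-exists o ind
    in  p , pending q , plan cannot σ ind pl
    where open Outcome o
  move-exists {xs = xs} {os} (pending-X {q} P _) with can-complete? xs os
  ... | inj₁ (c , free , completes) = c , _ , deviate pending free completes
  ... | inj₂ cannot = q , finished , continue cannot
  -- O's last stone y can occupy only one of the two completing cells.
  move-exists (finished-X {y = y} _ _ D _ _) with Double.c₁ D ≟ᶜ y
  ... | yes refl = c₂ , finished , deviate finished (proj₁ c₂-free ,
        λ { (here c₂≡y) → c₁≢c₂ (sym c₂≡y) ; (there c₂∈) → proj₂ c₂-free c₂∈ }) c₂-completes
    where open Double D
  ... | no c₁≢y = c₁ , finished , deviate finished (proj₁ c₁-free ,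
        λ { (here c₁≡y) → c₁≢y c₁≡y ; (there c₁∈) → proj₂ c₁-free c₁∈ }) c₁-completes
    where open Double D

  record Undecided (xs os : Cells) : Set where
    field
      not-lost : ν os ≢ 4 + m
      in-time  : length xs + length os < 2 * (4 + m) + 3

  -- With at most n + 1 stones each, at most 2n + 2 plies have been played.
  undecided : ∀ {xs os} → ν os ≢ 4 + m → length xs ≤ 5 + m → length os ≤ 5 + m → Undecided xs os
  undecided ν≢ few few′ = record
    { not-lost = ν≢
    ; in-time  = ℕ.≤-<-trans (ℕ.+-mono-≤ few few′) (ℕ.≤-reflexive
        (solve 1 (λ k → con 1 :+ ((con 5 :+ k) :+ (con 5 :+ k)) := con 2 :* (con 4 :+ k) :+ con 3) refl m))
    }
    where open +-*-Solver

  -- O's at most n - 1 stones are too few for a transversal.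
  undecided-early : ∀ {xs os} → length xs ≤ 5 + m → length os ≤ 3 + m → Undecided xs os
  undecided-early {os = os} few few′ =
    undecided (ℕ.<⇒≢ (s≤s (ℕ.≤-trans (ν≤length os) few′))) few (ℕ.m≤n⇒m≤o+n 2 few′)

  won-or-undecided : ∀ {t p xs os} → State t p xs os → ν xs ≡ 4 + m ⊎ Undecided xs os
  won-or-undecided (opening-X len few _ _) =
    inj₂ (undecided-early (ℕ.m≤n⇒m≤o+n 3 few) (ℕ.m≤n⇒m≤o+n 1 (subst (_≤ 2 + m) len few)))
  won-or-undecided (opening-O len few _ _) =
    inj₂ (undecided-early (ℕ.m≤n⇒m≤o+n 3 few) (ℕ.m≤n⇒m≤o+n 2 (ℕ.≤-pred (subst (_≤ 2 + m) len few))))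
  won-or-undecided (outcome-O o) = inj₂ (undecided-early
    (ℕ.m≤n⇒m≤o+n 2 (ℕ.≤-reflexive (cong suc length-M))) (ℕ.m≤n⇒m≤o+n 1 (ℕ.≤-reflexive length-F)))
    where open Outcome o
  won-or-undecided (outcome-X o) = inj₂ (undecided-early
    (ℕ.m≤n⇒m≤o+n 2 (ℕ.≤-reflexive (cong suc length-M))) (ℕ.≤-reflexive (cong suc length-F)))
    where open Outcome o
  won-or-undecided (pending-O P) = inj₂ (undecided-early
    (ℕ.m≤n⇒m≤o+n 1 (ℕ.≤-reflexive length-xs)) (ℕ.≤-reflexive length-os))
    where open Pending P
  won-or-undecided (pending-X {y = y} {os} P y∉) = inj₂ (undecided
    -- Here y need not be t: granting O the cell t as well only enlarges its set, and even then
    -- `safe` excludes a transversal.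
    (λ ν≡ → safe y y∉ (ν≡n (y ∷ t ∷ os) (subst (_≤ ν (y ∷ t ∷ os)) ν≡
      (ν-mono (y ∷ os) (y ∷ t ∷ os) λ { (here eq) → here eq ; (there ∈os) → there (there ∈os) }))))
    (ℕ.m≤n⇒m≤o+n 1 (ℕ.≤-reflexive length-xs)) (ℕ.m≤n⇒m≤o+n 1 (ℕ.≤-reflexive (cong suc length-os))))
    where open Pending P
  won-or-undecided (finished-O {os = os} len len′ D safe) = inj₂ (undecided
    -- O's set is enlarged by c₁, a cell outside X's stones, so that `safe` applies.
    (λ ν≡ → safe c₁ (proj₁ c₁-free) (ν≡n (c₁ ∷ os) (subst (_≤ ν (c₁ ∷ os)) ν≡ (ν-mono os (c₁ ∷ os) there))))
    (ℕ.≤-reflexive len) (ℕ.m≤n⇒m≤o+n 1 (ℕ.≤-reflexive len′)))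
    where open Double D
  won-or-undecided (finished-X len len′ _ safe y∉) = inj₂ (undecided (safe _ y∉)
    (ℕ.≤-reflexive len) (ℕ.≤-reflexive (cong suc len′)))
  won-or-undecided (won ν≡) = inj₁ ν≡

  -- By way of 2n + 3 ≤ 4n ≤ n * n. It rules out that an undecided game ends on a full board.
  2n+3≤n² : 2 * (4 + m) + 3 ≤ (4 + m) * (4 + m)
  2n+3≤n² = ℕ.≤-trans (ℕ.+-monoʳ-≤ (2 * (4 + m)) (ℕ.≤-trans (ℕ.m≤m+n 3 1) (ℕ.≤-trans (ℕ.m≤m+n 4 m) (ℕ.m≤n*m (4 + m) 2))))
    (ℕ.≤-trans (ℕ.≤-reflexive (sym (ℕ.*-distribʳ-+ (4 + m) 2 2))) (ℕ.*-monoˡ-≤ (4 + m) (ℕ.m≤m+n 4 m)))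

mainTheorem2 : (n : ℕ) → 4 ≤ n → Game.WellDefined n × Game.WinsByPly n (2 * n + 3)
mainTheorem2 (suc (suc (suc (suc m)))) (s≤s (s≤s (s≤s (s≤s z≤n)))) = well-defined , wins
  where
  open Game (4 + m)
  well-defined : WellDefined
  well-defined r _ = move-exists (reachable⇒state r) , prescribed-free (reachable⇒state r)
  wins : WinsByPly (2 * (4 + m) + 3)
  wins {xs = xs} {os} r end with won-or-undecided (reachable⇒state r) | end
  ... | inj₁ ν≡ | _                       = ν≡
  ... | inj₂ _  | inj₁ (inj₁ ν≡)          = ν≡
  ... | inj₂ u  | inj₁ (inj₂ (inj₁ ν≡))   = contradiction ν≡ (Undecided.not-lost u)
  ... | inj₂ u  | inj₁ (inj₂ (inj₂ full)) = contradiction full (not-full {xs = xs} {os} (ℕ.<-≤-trans (Undecided.in-time u) 2n+3≤n²))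
  ... | inj₂ u  | inj₂ at-end             = contradiction at-end (ℕ.<⇒≢ (Undecided.in-time u))
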